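{- Let $q$ be an odd prime power and let $\gamma\in\mathbb{F}_{q^2}$. If $\mathrm{char}(\mathbb{F}_{q^2})\neq3$, the polynomial $f(x)=x+\gamma\,\mathrm{Tr}\left(x^4-x^{q+3}\right)$ over $\mathbb{F}_{q^2}$ is a permutation polynomial if and only if $\gamma=0$. If $\mathrm{char}(\mathbb{F}_{q^2})=3$, the polynomial $f(x)=x+\gamma\,\mathrm{Tr}\left(x^4-x^{q+3}\right)$ over $\mathbb{F}_{q^2}$ is a permutation polynomial if and only if $\gamma\in\mathbb{F}_q$.
   Context: $\mathrm{Tr}:\mathbb{F}_{q^2}\to\mathbb{F}_q$ is the trace map $\mathrm{Tr}(x)=x+x^q$. A polynomial $f$ over $\mathbb{F}_{q^2}$ is a permutation polynomial if the map $x\mapsto f(x)$ is a bijection of $\mathbb{F}_{q^2}$ onto itself. $\mathrm{char}(\mathbb{F}_{q^2})$ is the characteristic of $\mathbb{F}_{q^2}$. -}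

module Defs where

open import Algebra.Bundles using (CommutativeRing; Semiring)
open import Algebra.Definitions using (Invertible)
open import Algebra.Morphism.Structures using (IsRingMonomorphism)
import Algebra.Definitions.RawSemiring as RawSemiringDefs
open import Data.Fin using (Fin)
open import Data.Nat as ℕ using (ℕ; suc)
open import Data.Nat.Divisibility using (_∣_)
open import Data.Nat.Primality using (Prime)
open import Data.Product using (∃; ∃₂; _×_)
open import Function.Bundles using (Inverse; _⇔_)
open import Function.Definitions using (Bijective)
open import Level using (Level; _⊔_)
open import Relation.Binary.PropositionalEquality using (_≡_; setoid)
open import Relation.Nullary using (¬_)

IsPrimePower : ℕ → Set
IsPrimePower q = ∃₂ λ p k → Prime p × q ≡ p ℕ.^ suc k

record Field (c ℓ : Level) : Set (Level.suc (c ⊔ ℓ)) where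
  field
    commutativeRing : CommutativeRing c ℓ

  open CommutativeRing commutativeRing public

  field
    1≉0     : 1# ≉ 0#
    inverse : ∀ x → x ≉ 0# → Invertible _≈_ 1# _*_ x

module _ {c ℓ : Level} (F : Field c ℓ) where
  open Field F using (Carrier; _≈_; 0#; 1#; semiring)
    renaming (_+_ to _⊕_; _*_ to _⊛_; _-_ to _⊖_; setoid to F-setoid)
  open RawSemiringDefs (Semiring.rawSemiring semiring)
    using (_^_) renaming (_×_ to _·_)

  HasOrder : ℕ → Set (c ⊔ ℓ)
  HasOrder n = Inverse F-setoid (setoid (Fin n))

  -- n ≥ 0 generates the kernel of ℤ → F; in particular the characteristic is
  -- 0 when no positive multiple of 1# vanishes.
  HasCharacteristic : ℕ → Set ℓ
  HasCharacteristic n = ∀ m → (m · 1# ≈ 0#) ⇔ (n ∣ m)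

  -- Polynomials enter only through the maps they induce on F.
  IsPermutation : (Carrier → Carrier) → Set (c ⊔ ℓ)
  IsPermutation f = Bijective _≈_ _≈_ f

  -- The trace to the subfield of order q, with values regarded in F itself.
  Tr : ℕ → Carrier → Carrier
  Tr q x = x ⊕ x ^ q

  traceMap : ℕ → Carrier → Carrier → Carrier
  traceMap q γ x = x ⊕ γ ⊛ Tr q (x ^ 4 ⊖ x ^ (q ℕ.+ 3))

-- A field embedding exhibiting K as a subfield of L.
record Embedding {c₁ ℓ₁ c₂ ℓ₂ : Level} (K : Field c₁ ℓ₁) (L : Field c₂ ℓ₂)
       : Set (c₁ ⊔ ℓ₁ ⊔ c₂ ⊔ ℓ₂) where
  private
    module K = Field K
    module L = Field L
  field
    ι                  : K.Carrier → L.Carrier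
    isRingMonomorphism : IsRingMonomorphism (CommutativeRing.rawRing K.commutativeRing)
                                            (CommutativeRing.rawRing L.commutativeRing) ι

  InSubfield : L.Carrier → Set (c₁ ⊔ ℓ₂)
  InSubfield x = ∃ λ a → ι a L.≈ x

{-# OPTIONS --safe #-}
module Submission where

-- Write x̄ = x^q. Then Tr(x⁴ - x^(q+3)) = (x - x̄)²(x² + x x̄ + x̄²), which for x = u + v with
-- ū = u and v̄ = - v equals 4v²(3u² + v²).
--
-- In characteristic 3 it is (x - x̄)⁴. If γ ∈ 𝔽q, then f preserves x - x̄ and is inverted by
-- y ↦ y - γ (y - ȳ)⁴; otherwise cubing, which is bijective, yields a second zero of f.
--
-- In other characteristics a collision is found for every γ ≠ 0. For γ ∈ 𝔽q this is a linear
-- equation. For γ = c + ω with ω̄ = - ω ≠ 0 and D = ω², a nonsquare of 𝔽q, it suffices to solve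
-- 12 D s u² + 4 D² s³ = - 1 in 𝔽q. If - 3 is a nonsquare, cubing is injective on 𝔽q and u = 0
-- works. If - 3 = e², the substitution s = 1/(D T), u = e W/(6 T) turns the equation into
-- W² = T³ + 4/D, and a map of Shallue and van de Woestijne provides three values of
-- T³ + 4/D whose product is a square, so that one of them is a square.

open import Defs
open import Algebra.Bundles using (CommutativeRing)
open import Algebra.Morphism.Structures using (IsRingMonomorphism)
import Algebra.Properties.AbelianGroup as AbelianGroupProperties
import Algebra.Properties.CommutativeMonoid.Sum as CommutativeMonoidSum
import Algebra.Properties.CommutativeSemiring.Binomial as Binomial
import Algebra.Properties.CommutativeSemiring.Exp as CommutativeSemiringExp
import Algebra.Properties.Group as GroupProperties
import Algebra.Properties.Monoid.Sum as MonoidSum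
import Algebra.Properties.Ring as RingProperties
import Algebra.Properties.Semiring.Exp as SemiringExp
import Algebra.Properties.Semiring.Mult as SemiringMult
import Algebra.Properties.Semiring.Mult.TCOptimised as OptimisedMult
import Algebra.Solver.Ring as RingSolver
open import Algebra.Solver.Ring.AlmostCommutativeRing
  using (fromCommutativeRing; _-Raw-AlmostCommutative⟶_)
open import Data.Fin as Fin using (Fin; zero; suc)
open import Data.Fin.Permutation using (Permutation′; permutation)
import Data.Fin.Properties as Fin
open import Data.Integer as ℤ using (ℤ; +_; -[1+_])
import Data.Integer.Properties as ℤ
open import Data.Maybe using (Maybe; just; nothing)
open import Data.Nat as ℕ using (ℕ; zero; suc; _!)
open import Data.Nat.Combinatorics using (_C_; nCn≡1; nCk≡n!/k![n-k]!; k![n∸k]!∣n!)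
open import Data.Nat.Coprimality using (Coprime; coprime-Bézout)
open import Data.Nat.Divisibility
  using (_∣_; _∤_; _∣?_; divides; ∣-refl; ∣1⇒≡1; ∣⇒≤; m∣m*n)
open import Data.Nat.DivMod using (m/n*n≡m)
open import Data.Nat.GCD using (module Bézout)
open import Data.Nat.Primality
  using (Prime; euclidsLemma; prime?; prime[2]; ¬prime[0]; ¬prime[1]; prime⇒irreducible)
import Data.Nat.Properties as ℕ
open import Data.Nat.Properties using (_!*_!≢0)
open import Data.Product using (∃; ∃₂; _×_; _,_; proj₁; proj₂)
open import Data.Sum using (_⊎_; inj₁; inj₂; [_,_]′)
open import Data.Vec using (Vec; []; _∷_)
open import Data.Vec.Functional using (Vector; removeAt)
open import Function.Base using (_∘_)
open import Function.Bundles using (Inverse; Equivalence; _⇔_; mk⇔)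
import Level
open import Relation.Binary.Core using (_Preserves_⟶_)
open import Relation.Binary.Definitions using (Decidable)
open import Relation.Binary.PropositionalEquality as ≡ using (_≡_)
import Relation.Binary.Reasoning.Setoid as SetoidReasoning
open import Relation.Nullary using (Dec; yes; no; ¬_; contradiction)
open import Relation.Nullary.Decidable using (map′; ¬?; decidable-stable; from-yes)

-- On 𝔽q the factor x - x̄ vanishes, so f is the identity there. For γ outside 𝔽q it is therefore
-- enough to find x outside 𝔽q with f x in 𝔽q. For x = u + s ω the value is x + γ · 4 s² D (3u² + s²
-- D); if the second summand equals - s γ, what remains is u - s c, and dividing that condition by s
-- γ gives the equation in s and u. For γ in 𝔽q no such x exists, because f then preserves x - x̄.
-- Collisions have to be sought inside one coset ω + 𝔽q, on which f is a quadratic polynomial in u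
-- with leading coefficient 12 γ ω². The factor 3 in it is what sets characteristic 3 apart. The
-- obstacle is that W² = T³ + 4/D has genus 1, so its points cannot be parametrized rationally. No
-- estimate for the number of points is invoked: the argument rests only on the fact that a product
-- of two nonsquares of a finite field is a square.

-- The library's ring solvers either take coefficients from the ring itself,
-- where 1# - 1# does not compute to 0#, or lack negation; integer coefficients
-- avoid both problems.
module IntegerCoefficients {c ℓ} (R : CommutativeRing c ℓ) where
  open CommutativeRing R
  open OptimisedMult semiring using (1+×; ×ᵤ≈×; ×-homo-+; ×1-homo-*) renaming (_×_ to _·_)
  open SemiringMult semiring using () renaming (_×_ to _×ᵤ_)
  open RingProperties ring using (-0#≈0#; -‿involutive; -‿distribˡ-*; -‿distribʳ-*)
  open AbelianGroupProperties +-abelianGroup using (⁻¹-∙-comm)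
  open SetoidReasoning setoid

  -- With the optimised multiple, `fromℤ (+ 1)` computes to `1#`, so that `refl` proves the unit law
  -- of `morphism`.
  fromℤ : ℤ → Carrier
  fromℤ (+ n)    = n · 1#
  fromℤ -[1+ n ] = - (suc n · 1#)

  private
    cancel-1 : ∀ x y → (1# + x) - (1# + y) ≈ x - y
    cancel-1 x y = begin
      (1# + x) + - (1# + y)    ≈⟨ +-cong (+-comm x 1#) (⁻¹-∙-comm 1# y) ⟨
      (x + 1#) + (- 1# + - y)  ≈⟨ +-assoc x 1# _ ⟩
      x + (1# + (- 1# + - y))  ≈⟨ +-congˡ (+-assoc 1# (- 1#) (- y)) ⟨
      x + ((1# - 1#) + - y)    ≈⟨ +-congˡ (+-congʳ (-‿inverseʳ 1#)) ⟩
      x + (0# + - y)           ≈⟨ +-congˡ (+-identityˡ (- y)) ⟩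
      x - y                    ∎

  num : ℕ → Carrier
  num n = fromℤ (+ n)

  ·1≈num : ∀ n → n ×ᵤ 1# ≈ num n
  ·1≈num n = ×ᵤ≈× n 1#

  num-suc : ∀ n → num (suc n) ≈ 1# + num n
  num-suc n = 1+× n 1#

  num-* : ∀ m n → num (m ℕ.* n) ≈ num m * num n
  num-* = ×1-homo-*

  fromℤ-⊖ : ∀ m n → fromℤ (m ℤ.⊖ n) ≈ m · 1# - n · 1#
  fromℤ-⊖ m zero = begin
    m · 1#         ≈⟨ +-identityʳ _ ⟨
    m · 1# + 0#    ≈⟨ +-congˡ -0#≈0# ⟨
    m · 1# + - 0#  ∎
  fromℤ-⊖ zero    (suc n) = sym (+-identityˡ _)
  fromℤ-⊖ (suc m) (suc n) = begin
    fromℤ (suc m ℤ.⊖ suc n)    ≡⟨ ≡.cong fromℤ (ℤ.[1+m]⊖[1+n]≡m⊖n m n) ⟩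
    fromℤ (m ℤ.⊖ n)            ≈⟨ fromℤ-⊖ m n ⟩
    m · 1# - n · 1#            ≈⟨ cancel-1 _ _ ⟨
    (1# + m · 1#) - (1# + n · 1#)  ≈⟨ +-cong (1+× m 1#) (-‿cong (1+× n 1#)) ⟨
    suc m · 1# - suc n · 1#    ∎

  fromℤ-neg : ∀ i → fromℤ (ℤ.- i) ≈ - fromℤ i
  fromℤ-neg (+ zero)  = sym -0#≈0#
  fromℤ-neg (+ suc n) = refl
  fromℤ-neg -[1+ n ]  = sym (-‿involutive _)

  fromℤ-+ : ∀ i j → fromℤ (i ℤ.+ j) ≈ fromℤ i + fromℤ j
  fromℤ-+ (+ m)    (+ n)    = ×-homo-+ 1# m n
  fromℤ-+ (+ m)    -[1+ n ] = fromℤ-⊖ m (suc n)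
  fromℤ-+ -[1+ m ] (+ n)    = trans (fromℤ-⊖ n (suc m)) (+-comm _ _)
  fromℤ-+ -[1+ m ] -[1+ n ] = begin
    fromℤ (-[1+ m ] ℤ.+ -[1+ n ])      ≡⟨ ≡.cong fromℤ (ℤ.neg-distrib-+ (+ suc m) (+ suc n)) ⟨
    fromℤ (ℤ.- (+ (suc m ℕ.+ suc n)))  ≈⟨ fromℤ-neg (+ (suc m ℕ.+ suc n)) ⟩
    - ((suc m ℕ.+ suc n) · 1#)         ≈⟨ -‿cong (×-homo-+ 1# (suc m) (suc n)) ⟩
    - (suc m · 1# + suc n · 1#)        ≈⟨ ⁻¹-∙-comm _ _ ⟨
    - (suc m · 1#) - suc n · 1#        ∎

  private
    fromℤ-pos-* : ∀ m n → fromℤ (+ m ℤ.* + n) ≈ fromℤ (+ m) * fromℤ (+ n)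
    fromℤ-pos-* m n = trans (reflexive (≡.cong fromℤ (≡.sym (ℤ.pos-* m n)))) (num-* m n)

    fromℤ-*-pos : ∀ i n → fromℤ (i ℤ.* + n) ≈ fromℤ i * fromℤ (+ n)
    fromℤ-*-pos (+ m)    n = fromℤ-pos-* m n
    fromℤ-*-pos -[1+ m ] n = begin
      fromℤ (-[1+ m ] ℤ.* + n)         ≡⟨ ≡.cong fromℤ (ℤ.neg-distribˡ-* (+ suc m) (+ n)) ⟨
      fromℤ (ℤ.- (+ suc m ℤ.* + n))    ≈⟨ fromℤ-neg (+ suc m ℤ.* + n) ⟩
      - fromℤ (+ suc m ℤ.* + n)        ≈⟨ -‿cong (fromℤ-pos-* (suc m) n) ⟩
      - (fromℤ (+ suc m) * fromℤ (+ n)) ≈⟨ -‿distribˡ-* _ _ ⟩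
      fromℤ -[1+ m ] * fromℤ (+ n)     ∎

  fromℤ-* : ∀ i j → fromℤ (i ℤ.* j) ≈ fromℤ i * fromℤ j
  fromℤ-* i (+ n)    = fromℤ-*-pos i n
  fromℤ-* i -[1+ n ] = begin
    fromℤ (i ℤ.* -[1+ n ])          ≡⟨ ≡.cong fromℤ (ℤ.neg-distribʳ-* i (+ suc n)) ⟨
    fromℤ (ℤ.- (i ℤ.* + suc n))     ≈⟨ fromℤ-neg (i ℤ.* + suc n) ⟩
    - fromℤ (i ℤ.* + suc n)         ≈⟨ -‿cong (fromℤ-*-pos i (suc n)) ⟩
    - (fromℤ i * fromℤ (+ suc n))   ≈⟨ -‿distribʳ-* _ _ ⟩
    fromℤ i * fromℤ -[1+ n ]        ∎

  private
    morphism : CommutativeRing.rawRing ℤ.+-*-commutativeRing -Raw-AlmostCommutative⟶ fromCommutativeRing R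
    morphism = record
      { ⟦_⟧    = fromℤ
      ; +-homo = fromℤ-+
      ; *-homo = fromℤ-*
      ; -‿homo = fromℤ-neg
      ; 0-homo = refl
      ; 1-homo = refl
      }

    coefficient≟ : ∀ i j → Maybe (fromℤ i ≈ fromℤ j)
    coefficient≟ i j with i ℤ.≟ j
    ... | yes i≡j = just (reflexive (≡.cong fromℤ i≡j))
    ... | no _    = nothing

  open RingSolver (CommutativeRing.rawRing ℤ.+-*-commutativeRing) (fromCommutativeRing R) morphism coefficient≟ public

  :num : ∀ {n} → ℕ → Polynomial n
  :num k = con (+ k)

-- Cancellation in fields and enumeration of finite fields

module FieldProperties {c ℓ} (F : Field c ℓ) where
  open Field F hiding (zero)
  open IntegerCoefficients commutativeRing using (solve; _:=_; :-_; :num)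
  open SetoidReasoning setoid
  open GroupProperties +-group public using ()
    renaming (x∙y⁻¹≈ε⇒x≈y to x-y≈0⇒x≈y)

  recip : ∀ x → x ≉ 0# → Carrier
  recip x x≉0 = proj₁ (inverse x x≉0)

  recip-inverseʳ : ∀ x (x≉0 : x ≉ 0#) → x * recip x x≉0 ≈ 1#
  recip-inverseʳ x x≉0 = proj₂ (proj₂ (inverse x x≉0))

  *-cancelˡ-≉0 : ∀ {x y z} → x ≉ 0# → x * y ≈ x * z → y ≈ z
  *-cancelˡ-≉0 {x} {y} {z} x≉0 xy≈xz = begin
    y                    ≈⟨ recip-* y ⟨
    recip x x≉0 * (x * y) ≈⟨ *-congˡ xy≈xz ⟩
    recip x x≉0 * (x * z) ≈⟨ recip-* z ⟩
    z                    ∎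
    where
    recip-* : ∀ w → recip x x≉0 * (x * w) ≈ w
    recip-* w = begin
      recip x x≉0 * (x * w)  ≈⟨ *-assoc _ x w ⟨
      recip x x≉0 * x * w    ≈⟨ *-congʳ (proj₁ (proj₂ (inverse x x≉0))) ⟩
      1# * w                 ≈⟨ *-identityˡ w ⟩
      w                      ∎

  x≉0∧xy≈0⇒y≈0 : ∀ {x y} → x ≉ 0# → x * y ≈ 0# → y ≈ 0#
  x≉0∧xy≈0⇒y≈0 x≉0 xy≈0 = *-cancelˡ-≉0 x≉0 (trans xy≈0 (sym (zeroʳ _)))

  *-≉0 : ∀ {x y} → x ≉ 0# → y ≉ 0# → x * y ≉ 0#
  *-≉0 x≉0 y≉0 xy≈0 = y≉0 (x≉0∧xy≈0⇒y≈0 x≉0 xy≈0)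

  factorˡ-≉0 : ∀ {x y} → x * y ≉ 0# → x ≉ 0#
  factorˡ-≉0 xy≉0 x≈0 = xy≉0 (trans (*-congʳ x≈0) (zeroˡ _))

  factorʳ-≉0 : ∀ {x y} → x * y ≉ 0# → y ≉ 0#
  factorʳ-≉0 xy≉0 y≈0 = xy≉0 (trans (*-congˡ y≈0) (zeroʳ _))

  recip-≉0 : ∀ x (x≉0 : x ≉ 0#) → recip x x≉0 ≉ 0#
  recip-≉0 x x≉0 = factorʳ-≉0 (λ xr≈0 → 1≉0 (trans (sym (recip-inverseʳ x x≉0)) xr≈0))

  -‿≉0 : ∀ {x} → x ≉ 0# → - x ≉ 0#
  -‿≉0 {x} x≉0 -x≈0 = x≉0 (begin
    x       ≈⟨ solve 1 (λ x → x := :- (:- x)) refl x ⟩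
    - (- x) ≈⟨ -‿cong -x≈0 ⟩
    - 0#    ≈⟨ solve 0 (:- :num 0 := :num 0) refl ⟩
    0#      ∎)

module FiniteFieldProperties {c ℓ} (F : Field c ℓ) {n : ℕ} (order : HasOrder F n) where
  open Field F hiding (zero)
  open FieldProperties F
  open Inverse order using (to; from; to-cong; strictlyInverseˡ; strictlyInverseʳ)
  open IntegerCoefficients commutativeRing using (solve; _:=_; _:+_; _:*_; _:-_; :-_; :num)
  open SemiringMult semiring renaming (_×_ to _·_) using ()
  open SetoidReasoning setoid

  to-injective : ∀ {x y} → to x ≡ to y → x ≈ y
  to-injective {x} {y} eq =
    trans (sym (strictlyInverseʳ x)) (trans (reflexive (≡.cong from eq)) (strictlyInverseʳ y))

  infix 4 _≟_
  _≟_ : Decidable _≈_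
  x ≟ y = map′ to-injective to-cong (to x Fin.≟ to y)

  xy≈0⇒x≈0⊎y≈0 : ∀ {x y} → x * y ≈ 0# → x ≈ 0# ⊎ y ≈ 0#
  xy≈0⇒x≈0⊎y≈0 {x} xy≈0 with x ≟ 0#
  ... | yes x≈0 = inj₁ x≈0
  ... | no  x≉0 = inj₂ (x≉0∧xy≈0⇒y≈0 x≉0 xy≈0)

  x²≈y²⇒x≈y⊎x≈-y : ∀ {x y} → x * x ≈ y * y → x ≈ y ⊎ x ≈ - y
  x²≈y²⇒x≈y⊎x≈-y {x} {y} x²≈y² with xy≈0⇒x≈0⊎y≈0 {x - y} {x + y} (begin
      (x - y) * (x + y)  ≈⟨ solve 2 (λ x y → (x :- y) :* (x :+ y) := x :* x :- y :* y) refl x y ⟩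
      x * x - y * y      ≈⟨ +-congʳ x²≈y² ⟩
      y * y - y * y      ≈⟨ -‿inverseʳ _ ⟩
      0#                 ∎)
  ... | inj₁ x-y≈0 = inj₁ (x-y≈0⇒x≈y x y x-y≈0)
  ... | inj₂ x+y≈0 = inj₂ (x-y≈0⇒x≈y x (- y)
          (trans (solve 2 (λ x y → x :- (:- y) := x :+ y) refl x y) x+y≈0))

  -- A missed value `y` could be put in front of the n values of `h`, which would give n + 1
  -- distinct elements.
  injective⇒surjective : ∀ {h : Carrier → Carrier} → (∀ {x y} → h x ≈ h y → x ≈ y) →
                         ∀ y → ∃ λ x → h x ≈ y
  injective⇒surjective {h} h-injective y with Fin.any? (λ i → h (from i) ≟ y)
  ... | yes (i , hi≈y) = from i , hi≈y
  ... | no  y∉h        = contradiction (Fin.injective⇒≤ {f = y∷h} (λ {i} {j} → y∷h-injective i j)) ℕ.1+n≰n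
    where
    y∷h : Fin (suc n) → Fin n
    y∷h zero    = to y
    y∷h (suc i) = to (h (from i))

    y∷h-injective : ∀ i j → y∷h i ≡ y∷h j → i ≡ j
    y∷h-injective zero    zero    _  = ≡.refl
    y∷h-injective zero    (suc j) eq = contradiction (j , to-injective (≡.sym eq)) y∉h
    y∷h-injective (suc i) zero    eq = contradiction (i , to-injective eq) y∉h
    y∷h-injective (suc i) (suc j) eq = ≡.cong suc (≡.trans (≡.sym (strictlyInverseˡ i))
      (≡.trans (to-cong (h-injective (to-injective eq))) (strictlyInverseˡ j)))

  -- Sums and products over the field run over `Fin n`, so a bijection of the field must become a
  -- permutation of indices before their invariance applies.
  relabel : ∀ {h k : Carrier → Carrier} → h Preserves _≈_ ⟶ _≈_ → k Preserves _≈_ ⟶ _≈_ →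
            (∀ x → h (k x) ≈ x) → (∀ x → k (h x) ≈ x) → Permutation′ n
  relabel {h} {k} h-cong k-cong hk kh = permutation (to ∘ h ∘ from) (to ∘ k ∘ from)
    (λ i → ≡.trans (to-cong (trans (h-cong (strictlyInverseʳ _)) (hk (from i)))) (strictlyInverseˡ i))
    (λ i → ≡.trans (to-cong (trans (k-cong (strictlyInverseʳ _)) (kh (from i)))) (strictlyInverseˡ i))

  -- Translation by 1# permutes the field, so it does not change the sum of all elements.
  order·1≈0 : n · 1# ≈ 0#
  order·1≈0 = sym (x-y≈0⇒x≈y 0# (n · 1#) (begin
    0# - n · 1#                           ≈⟨ solve 2 (λ s k → :num 0 :- k := s :- (s :+ k)) refl Σx (n · 1#) ⟩
    Σx - (Σx + n · 1#)                    ≈⟨ +-congˡ (-‿cong Σx≈Σx+n) ⟨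
    Σx - Σx                               ≈⟨ -‿inverseʳ Σx ⟩
    0#                                    ∎))
    where
    open CommutativeMonoidSum +-commutativeMonoid
    Σx = sum {n} from
    shift : Permutation′ n
    shift = relabel {_+ 1#} {_- 1#} +-congʳ +-congʳ
      (solve 1 (λ x → (x :- :num 1) :+ :num 1 := x) refl)
      (solve 1 (λ x → (x :+ :num 1) :- :num 1 := x) refl)
    Σx≈Σx+n : Σx ≈ Σx + n · 1#
    Σx≈Σx+n = begin
      Σx                                ≈⟨ sum-permute from shift ⟩
      sum (λ i → from (to (from i + 1#))) ≈⟨ sum-cong-≋ (λ i → strictlyInverseʳ (from i + 1#)) ⟩
      sum (λ i → from i + 1#)           ≈⟨ ∑-distrib-+ from (λ _ → 1#) ⟩
      Σx + sum {n} (λ _ → 1#)           ≈⟨ +-congˡ (sum-replicate n) ⟩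
      Σx + n · 1#                       ∎

-- Products over a finite field and Fermat's little theorem

module LittleFermat {c ℓ} (F : Field c ℓ) {n : ℕ} (order : HasOrder F n) where
  open Field F hiding (zero)
  open FieldProperties F
  open FiniteFieldProperties F order
  open Inverse order using (to; from; to-cong; strictlyInverseˡ; strictlyInverseʳ)
  open SemiringExp semiring using (_^_; ^-congˡ)
  open CommutativeMonoidSum *-commutativeMonoid using ()
    renaming (sum to product; sum-permute to product-permute; sum-cong-≋ to product-cong;
              sum-remove to product-remove; sum-replicate to product-replicate;
              ∑-distrib-+ to product-distrib-*)
  open SetoidReasoning setoid

  private
    ifZero_then_else_ : Carrier → Carrier → Carrier → Carrier
    ifZero x then y else z with x ≟ 0#
    ... | yes _ = y
    ... | no  _ = z

    ifZero-yes : ∀ {x y z} → x ≈ 0# → ifZero x then y else z ≈ y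
    ifZero-yes {x} x≈0 with x ≟ 0#
    ... | yes _   = refl
    ... | no  x≉0 = contradiction x≈0 x≉0

    ifZero-no : ∀ {x y z} → x ≉ 0# → ifZero x then y else z ≈ z
    ifZero-no {x} x≉0 with x ≟ 0#
    ... | yes x≈0 = contradiction x≈0 x≉0
    ... | no  _   = refl

    -- Replacing 0 by 1 turns the product over all n indices into the product of the nonzero
    -- elements, without enumerating the latter.
    unit : Carrier → Carrier
    unit x = ifZero x then 1# else x

    unit-cong : unit Preserves _≈_ ⟶ _≈_
    unit-cong {x} {y} x≈y with x ≟ 0#
    ... | yes x≈0 = sym (ifZero-yes (trans (sym x≈y) x≈0))
    ... | no  x≉0 = trans x≈y (sym (ifZero-no (x≉0 ∘ trans x≈y)))

    unit-≉0 : ∀ x → unit x ≉ 0#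
    unit-≉0 x with x ≟ 0#
    ... | yes _   = 1≉0
    ... | no  x≉0 = x≉0

    product-≉0 : ∀ {k} (f : Vector Carrier k) → (∀ i → f i ≉ 0#) → product f ≉ 0#
    product-≉0 {zero}  f f≉0 = 1≉0
    product-≉0 {suc k} f f≉0 = *-≉0 (f≉0 zero) (product-≉0 (f ∘ suc) (f≉0 ∘ suc))

    -- Isolates the exponent n - 1: among the n factors `weight y`, only the one at `y = 0` is 1.
    product-indicator : ∀ {k} (f : Vector Carrier (suc k)) i {a} → f i ≈ 1# →
                        (∀ j → j ≡.≢ i → f j ≈ a) → product f ≈ a ^ k
    product-indicator {k} f i {a} fi≈1 fj≈a = begin
      product f                      ≈⟨ product-remove {i = i} f ⟩
      f i * product (removeAt f i)   ≈⟨ *-cong fi≈1 (product-cong (λ j → fj≈a _ (Fin.punchInᵢ≢i i j))) ⟩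
      1# * product {k} (λ _ → a)     ≈⟨ *-identityˡ _ ⟩
      product {k} (λ _ → a)          ≈⟨ product-replicate k ⟩
      a ^ k                          ∎

  -- Multiplication by x permutes the nonzero elements, so it does not change their product.
  x≉0⇒x^n≈x : ∀ {x} → x ≉ 0# → x ^ n ≈ x
  x≉0⇒x^n≈x {x} x≉0 = x^n≈x ≡.refl
    where
    Πunit = product {n} (unit ∘ from)
    -- Multiplication by `x` fixes 0, where `unit` stays 1; every other element contributes a factor
    -- `x`.
    weight : Carrier → Carrier
    weight y = ifZero y then 1# else x
    scale : Permutation′ n
    scale = relabel {x *_} {recip x x≉0 *_} *-congˡ *-congˡ
      (λ y → trans (sym (*-assoc _ _ _)) (trans (*-congʳ (recip-inverseʳ x x≉0)) (*-identityˡ y)))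
      (λ y → trans (sym (*-assoc _ _ _))
        (trans (*-congʳ (trans (*-comm _ _) (recip-inverseʳ x x≉0))) (*-identityˡ y)))
    unit-scale : ∀ y → unit (x * y) ≈ weight y * unit y
    unit-scale y with y ≟ 0#
    ... | yes y≈0 = trans (ifZero-yes (trans (*-congˡ y≈0) (zeroʳ x))) (sym (*-identityˡ 1#))
    ... | no  y≉0 = ifZero-no (*-≉0 x≉0 y≉0)
    Πunit≈Πweight*Πunit : Πunit * product {n} (weight ∘ from) ≈ Πunit * 1#
    Πunit≈Πweight*Πunit = begin
      Πunit * product {n} (weight ∘ from)             ≈⟨ *-comm _ _ ⟩
      product {n} (weight ∘ from) * Πunit             ≈⟨ product-distrib-* (weight ∘ from) (unit ∘ from) ⟨
      product {n} (λ i → weight (from i) * unit (from i)) ≈⟨ product-cong (λ i → sym (unit-scale (from i))) ⟩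
      product {n} (λ i → unit (x * from i))           ≈⟨ product-cong {n} (λ i → unit-cong {x * from i} (sym (strictlyInverseʳ _))) ⟩
      product {n} (λ i → unit (from (to (x * from i)))) ≈⟨ product-permute (unit ∘ from) scale ⟨
      Πunit                                           ≈⟨ *-identityʳ Πunit ⟨
      Πunit * 1#                                      ∎
    Πweight≈1 : product {n} (weight ∘ from) ≈ 1#
    Πweight≈1 = *-cancelˡ-≉0 (product-≉0 (unit ∘ from) (unit-≉0 ∘ from)) Πunit≈Πweight*Πunit
    x^n≈x : ∀ {m} → m ≡ n → x ^ m ≈ x
    x^n≈x {zero}  ≡.refl = contradiction (to 0#) Fin.¬Fin0
    x^n≈x {suc m} ≡.refl = begin
      x * x ^ m                       ≈⟨ *-congˡ (product-indicator (weight ∘ from) (to 0#)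
                                           (ifZero-yes (strictlyInverseʳ 0#))
                                           (λ j j≢0 → ifZero-no (λ fj≈0 → j≢0
                                             (≡.trans (≡.sym (strictlyInverseˡ j)) (to-cong fj≈0))))) ⟨
      x * product {n} (weight ∘ from) ≈⟨ *-congˡ Πweight≈1 ⟩
      x * 1#                          ≈⟨ *-identityʳ x ⟩
      x                               ∎

  x^n≈x : ∀ x → x ^ n ≈ x
  x^n≈x x with x ≟ 0#
  ... | no  x≉0 = x≉0⇒x^n≈x x≉0
  ... | yes x≈0 = trans (^-congˡ n x≈0) (trans (0^n≈0 ≡.refl) (sym x≈0))
    where
    0^n≈0 : ∀ {m} → m ≡ n → 0# ^ m ≈ 0#
    0^n≈0 {zero}  ≡.refl = contradiction (to 0#) Fin.¬Fin0
    0^n≈0 {suc m} _      = zeroˡ _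

-- Squares and nonsquares of a finite field

module Squares {c ℓ} (F : Field c ℓ) {n : ℕ} (order : HasOrder F n) where
  open Field F hiding (zero)
  open FieldProperties F
  open FiniteFieldProperties F order
  open Inverse order using (to; from; to-cong; strictlyInverseʳ)
  open IntegerCoefficients commutativeRing using (solve; _:=_; _:*_; :-_; :num)
  open SetoidReasoning setoid

  Square : Carrier → Set (c Level.⊔ ℓ)
  Square x = ∃ λ r → r * r ≈ x

  square? : ∀ x → Dec (Square x)
  square? x = map′ (λ (i , eq) → from i , eq)
                   (λ (r , eq) → to r , trans (*-cong (strictlyInverseʳ r) (strictlyInverseʳ r)) eq)
                   (Fin.any? (λ i → from i * from i ≟ x))

  Square-resp-≈ : ∀ {x y} → x ≈ y → Square x → Square y
  Square-resp-≈ x≈y (r , r²≈x) = r , trans r²≈x x≈y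

  Square-* : ∀ {x y} → Square x → Square y → Square (x * y)
  Square-* (r , r²≈x) (s , s²≈y) = r * s ,
    trans (solve 2 (λ r s → (r :* s) :* (r :* s) := (r :* r) :* (s :* s)) refl r s) (*-cong r²≈x s²≈y)

  Square-cancel-* : ∀ {x y} r → r ≉ 0# → (r * r) * x ≈ y → Square y → Square x
  Square-cancel-* {x} {y} r r≉0 r²x≈y (s , s²≈y) = r⁻¹ * s , (begin
    (r⁻¹ * s) * (r⁻¹ * s)                ≈⟨ solve 2 (λ r s → (r :* s) :* (r :* s) := r :* r :* (s :* s)) refl r⁻¹ s ⟩
    (r⁻¹ * r⁻¹) * (s * s)                ≈⟨ *-congˡ (trans s²≈y (sym r²x≈y)) ⟩
    (r⁻¹ * r⁻¹) * ((r * r) * x)          ≈⟨ solve 3 (λ r i x → i :* i :* (r :* r :* x) := r :* i :* (r :* i) :* x) refl r r⁻¹ x ⟩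
    ((r * r⁻¹) * (r * r⁻¹)) * x          ≈⟨ *-congʳ (*-cong (recip-inverseʳ r r≉0) (recip-inverseʳ r r≉0)) ⟩
    (1# * 1#) * x                        ≈⟨ trans (*-congʳ (*-identityˡ 1#)) (*-identityˡ x) ⟩
    x                                    ∎)
    where r⁻¹ = recip r r≉0

  private
    -- x lies in a set of representatives of the pairs {x , - x}.
    Positive : Carrier → Set
    Positive x = to x Fin.≤ to (- x)

    module _ {ν : Carrier} (¬Square[ν] : ¬ Square ν) where

      fold : Carrier → Carrier
      fold x with to x Fin.≤? to (- x)
      ... | yes _ = x * x
      ... | no  _ = ν * (x * x)

      ν≉0 : ν ≉ 0#
      ν≉0 ν≈0 = ¬Square[ν] (0# , trans (zeroˡ 0#) (sym ν≈0))

      to-neg-neg : ∀ x → to (- (- x)) ≡ to x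
      to-neg-neg x = to-cong (solve 1 (λ x → :- (:- x) := x) refl x)

      same-sign : ∀ {x y} → (x ≈ - y → x ≈ y) → x * x ≈ y * y → x ≈ y
      same-sign x≈-y⇒x≈y x²≈y² with x²≈y²⇒x≈y⊎x≈-y x²≈y²
      ... | inj₁ x≈y  = x≈y
      ... | inj₂ x≈-y = x≈-y⇒x≈y x≈-y

      -- The hypotheses are contradictory: dividing by y² would make `ν` a square, and y = 0 is
      -- excluded because 0 = - 0 is positive.
      opposite-sign : ∀ {x y} → ¬ Positive y → x * x ≈ ν * (y * y) → x ≈ y
      opposite-sign {x} {y} y-neg x²≈νy² = contradiction
        (Square-cancel-* y y≉0 (*-comm (y * y) ν) (x , x²≈νy²)) ¬Square[ν]
        where
        y≉0 : y ≉ 0#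
        y≉0 y≈0 = y-neg (ℕ.≤-reflexive (≡.cong Fin.toℕ (to-cong
          (trans y≈0 (trans (solve 0 (:num 0 := :- :num 0) refl) (-‿cong (sym y≈0)))))))

      -- Within one sign class x² determines x: opposite elements of the same class have equal
      -- indices, or contradict each other's sign. Values from different classes never meet, as
      -- their quotient would make `ν` a square.
      fold-injective : ∀ {x y} → fold x ≈ fold y → x ≈ y
      fold-injective {x} {y} eq with to x Fin.≤? to (- x) | to y Fin.≤? to (- y)
      ... | yes x-pos | yes y-pos = same-sign (λ x≈-y → to-injective (Fin.≤-antisym
              (≡.subst₂ Fin._≤_ ≡.refl (≡.trans (to-cong (-‿cong x≈-y)) (to-neg-neg y)) x-pos)
              (≡.subst (to y Fin.≤_) (≡.sym (to-cong x≈-y)) y-pos))) eq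
      ... | no  x-neg | no  y-neg = same-sign (λ x≈-y → contradiction
              (≡.subst₂ Fin._≤_ (≡.sym (to-cong x≈-y)) (≡.trans (≡.sym (to-neg-neg y)) (to-cong (-‿cong (sym x≈-y))))
                (ℕ.<⇒≤ (ℕ.≰⇒> y-neg))) x-neg) (*-cancelˡ-≉0 ν≉0 eq)
      ... | yes _     | no  y-neg = opposite-sign y-neg eq
      ... | no  x-neg | yes _     = sym (opposite-sign x-neg (sym eq))

  -- A nonsquare ν turns squaring into a bijection, by sending one of each pair {x , - x} to x²
  -- and the other to ν x².
  nonsquare-*-nonsquare : ∀ {x y} → ¬ Square x → ¬ Square y → Square (x * y)
  nonsquare-*-nonsquare {x} {y} ¬Square[x] ¬Square[y]
    with injective⇒surjective (fold-injective ¬Square[x]) y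
  ... | z , fold≈y with to z Fin.≤? to (- z)
  ... | yes _ = contradiction (z , fold≈y) ¬Square[y]
  -- As y is a nonsquare, its preimage z lies in the second class, so y = x z² and x y = (x z)².
  ... | no  _ = x * z , (begin
    (x * z) * (x * z)  ≈⟨ solve 2 (λ x z → x :* z :* (x :* z) := x :* (x :* (z :* z))) refl x z ⟩
    x * (x * (z * z))  ≈⟨ *-congˡ fold≈y ⟩
    x * y              ∎)

-- Binomial coefficients modulo p and the Frobenius map

prime∤! : ∀ {p} → Prime p → ∀ {k} → k ℕ.< p → p ∤ k !
prime∤! {p} p-prime {zero}  0<p p∣1 = contradiction (≡.subst Prime (∣1⇒≡1 p∣1) p-prime) ¬prime[1]
prime∤! {p} p-prime {suc k} k<p p∣k! with euclidsLemma (suc k) (k !) p-prime p∣k!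
... | inj₁ p∣1+k = ℕ.<⇒≱ k<p (∣⇒≤ p∣1+k)
... | inj₂ p∣k!′ = prime∤! p-prime (ℕ.<-trans (ℕ.n<1+n k) k<p) p∣k!′

-- The prime divides p! = (p C k) · k! · (p - k)!, but neither of the two factorials on the right.
prime∣C : ∀ {p} → Prime p → ∀ {k} → 0 ℕ.< k → k ℕ.< p → p ∣ (p C k)
prime∣C {p} p-prime {k} 0<k k<p with euclidsLemma (p C k) (k ! ℕ.* (p ℕ.∸ k) !) p-prime p∣C*k!*[p-k]!
  where
  instance _ = k !* (p ℕ.∸ k) !≢0
  C*k!*[p-k]!≡p! : (p C k) ℕ.* (k ! ℕ.* (p ℕ.∸ k) !) ≡ p !
  C*k!*[p-k]!≡p! = ≡.trans (≡.cong (ℕ._* (k ! ℕ.* (p ℕ.∸ k) !)) (nCk≡n!/k![n-k]! (ℕ.<⇒≤ k<p)))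
                           (m/n*n≡m (k![n∸k]!∣n! (ℕ.<⇒≤ k<p)))
  p∣p! : ∀ {m} → 0 ℕ.< m → m ∣ m !
  p∣p! {suc m} _ = m∣m*n (m !)
  p∣C*k!*[p-k]! : p ∣ (p C k) ℕ.* (k ! ℕ.* (p ℕ.∸ k) !)
  p∣C*k!*[p-k]! = ≡.subst (p ∣_) (≡.sym C*k!*[p-k]!≡p!) (p∣p! (ℕ.<-trans 0<k k<p))
... | inj₁ p∣C = p∣C
... | inj₂ p∣k!*[p-k]! with euclidsLemma (k !) ((p ℕ.∸ k) !) p-prime p∣k!*[p-k]!
... | inj₁ p∣k!     = contradiction p∣k! (prime∤! p-prime k<p)
... | inj₂ p∣[p-k]! = contradiction p∣[p-k]! (prime∤! p-prime (ℕ.∸-monoʳ-< 0<k (ℕ.<⇒≤ k<p)))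

module Frobenius {c ℓ} (R : CommutativeRing c ℓ) {p : ℕ} (p-prime : Prime p) where
  open CommutativeRing R hiding (zero)
  open SemiringExp semiring using (_^_; ^-congˡ; ^-assocʳ)
  open SemiringMult semiring renaming (_×_ to _·_) using (×-assoc-*; ×-assocˡ)
  open MonoidSum +-monoid using (sum; sum-cong-≋; sum-replicate-zero; sum-init-last)
  open Binomial commutativeSemiring using (binomial; theorem)
  open SetoidReasoning setoid

  module _ (p·1≈0 : p · 1# ≈ 0#) where

    p∣m⇒m·x≈0 : ∀ {m} → p ∣ m → ∀ x → m · x ≈ 0#
    p∣m⇒m·x≈0 (divides k ≡.refl) x = begin
      (k ℕ.* p) · x        ≡⟨ ≡.cong (_· x) (ℕ.*-comm k p) ⟩
      (p ℕ.* k) · x        ≈⟨ ×-assocˡ x p k ⟨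
      p · (k · x)          ≈⟨ p·y≈0 (k · x) ⟩
      0#                   ∎
      where
      p·y≈0 : ∀ y → p · y ≈ 0#
      p·y≈0 y = begin
        p · y           ≈⟨ SemiringMult.×-congʳ semiring p (*-identityˡ y) ⟨
        p · (1# * y)    ≈⟨ ×-assoc-* p 1# y ⟨
        p · 1# * y      ≈⟨ *-congʳ p·1≈0 ⟩
        0# * y          ≈⟨ zeroˡ y ⟩
        0#              ∎

    -- Only the first and the last binomial term survive. To split them off, the exponent is
    -- generalised to a variable `m` that can be matched as a successor.
    frobenius-+ : ∀ x y → (x + y) ^ p ≈ x ^ p + y ^ p
    frobenius-+ x y = freshman ≡.refl
      where
      freshman : ∀ {m} → m ≡ p → (x + y) ^ m ≈ x ^ m + y ^ m
      freshman {zero}  0≡p = contradiction (≡.subst Prime (≡.sym 0≡p) p-prime) ¬prime[0]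
      freshman {suc m} 1+m≡p = begin
        (x + y) ^ suc m                           ≈⟨ theorem (suc m) x y ⟩
        t zero + sum (t ∘ suc)                    ≈⟨ +-cong t₀≈y^p (sum-init-last (t ∘ suc)) ⟩
        y ^ suc m + (sum (λ j → t (suc (Fin.inject₁ j))) + t (suc (Fin.fromℕ m)))
                                                  ≈⟨ +-congˡ (+-cong (trans (sum-cong-≋ t≈0) (sum-replicate-zero m)) t-last≈x^p) ⟩
        y ^ suc m + (0# + x ^ suc m)              ≈⟨ +-congˡ (+-identityˡ _) ⟩
        y ^ suc m + x ^ suc m                     ≈⟨ +-comm _ _ ⟩
        x ^ suc m + y ^ suc m                     ∎
        where
        t : Fin (suc (suc m)) → Carrier
        t k = (suc m C Fin.toℕ k) · binomial x y (suc m) k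
        t₀≈y^p : t zero ≈ y ^ suc m
        t₀≈y^p = trans (+-identityʳ _) (*-identityˡ _)
        t≈0 : ∀ j → t (suc (Fin.inject₁ j)) ≈ 0#
        t≈0 j = p∣m⇒m·x≈0 (≡.subst (λ q → q ∣ suc m C suc (Fin.toℕ (Fin.inject₁ j))) 1+m≡p
          (prime∣C (≡.subst Prime (≡.sym 1+m≡p) p-prime) ℕ.z<s
            (ℕ.s<s (≡.subst (ℕ._< m) (≡.sym (Fin.toℕ-inject₁ j)) (Fin.toℕ<n j))))) _
        t-last≈x^p : t (suc (Fin.fromℕ m)) ≈ x ^ suc m
        t-last≈x^p = begin
          (suc m C suc (Fin.toℕ (Fin.fromℕ m))) · (x ^ suc (Fin.toℕ (Fin.fromℕ m)) * y ^ (m ℕ.∸ Fin.toℕ (Fin.fromℕ m)))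
            ≡⟨ ≡.cong (λ k → (suc m C suc k) · (x ^ suc k * y ^ (m ℕ.∸ k))) (Fin.toℕ-fromℕ m) ⟩
          (suc m C suc m) · (x ^ suc m * y ^ (m ℕ.∸ m))
            ≡⟨ ≡.cong₂ (λ k l → k · (x ^ suc m * y ^ l)) (nCn≡1 (suc m)) (ℕ.n∸n≡0 m) ⟩
          1 · (x ^ suc m * 1#)
            ≈⟨ trans (+-identityʳ _) (*-identityʳ _) ⟩
          x ^ suc m ∎

    frobenius-^-+ : ∀ k x y → (x + y) ^ (p ℕ.^ k) ≈ x ^ (p ℕ.^ k) + y ^ (p ℕ.^ k)
    frobenius-^-+ zero    x y = trans (*-identityʳ _) (sym (+-cong (*-identityʳ x) (*-identityʳ y)))
    frobenius-^-+ (suc k) x y = begin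
      (x + y) ^ (p ℕ.* p ℕ.^ k)                   ≈⟨ ^-assocʳ (x + y) p (p ℕ.^ k) ⟨
      ((x + y) ^ p) ^ (p ℕ.^ k)                   ≈⟨ ^-congˡ (p ℕ.^ k) (frobenius-+ x y) ⟩
      (x ^ p + y ^ p) ^ (p ℕ.^ k)                 ≈⟨ frobenius-^-+ k (x ^ p) (y ^ p) ⟩
      (x ^ p) ^ (p ℕ.^ k) + (y ^ p) ^ (p ℕ.^ k)   ≈⟨ +-cong (^-assocʳ x p (p ℕ.^ k)) (^-assocʳ y p (p ℕ.^ k)) ⟩
      x ^ (p ℕ.* p ℕ.^ k) + y ^ (p ℕ.* p ℕ.^ k)   ∎

-- Counting the roots of a polynomial

module Roots {c ℓ} (F : Field c ℓ) where
  open Field F hiding (zero)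
  open FieldProperties F
  open IntegerCoefficients commutativeRing using (solve; _:=_; _:+_; _:*_; _:-_; :-_; :num)
  open SemiringExp semiring using (_^_)
  open SetoidReasoning setoid

  -- Coefficients are listed from the constant term upwards.
  eval : ∀ {n} → Vec Carrier n → Carrier → Carrier
  eval []       x = 0#
  eval (c ∷ cs) x = c + x * eval cs x

  leading : ∀ {n} → Vec Carrier (suc n) → Carrier
  leading (c ∷ [])      = c
  leading (_ ∷ d ∷ cs)  = leading (d ∷ cs)

  -- The quotient by X - r of a polynomial with nonconstant coefficients cs (Horner's scheme).
  horner : ∀ {n} → Carrier → Vec Carrier n → Vec Carrier n
  horner r []       = []
  horner r (c ∷ cs) = eval (c ∷ cs) r ∷ horner r cs

  eval-horner : ∀ {n} r x c (cs : Vec Carrier n) →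
                eval (c ∷ cs) x ≈ eval (c ∷ cs) r + (x - r) * eval (horner r cs) x
  eval-horner r x c [] =
    solve 3 (λ r x c → c :+ x :* :num 0 := c :+ r :* :num 0 :+ (x :- r) :* :num 0) refl r x c
  eval-horner r x c (d ∷ ds) = begin
    c + x * eval (d ∷ ds) x      ≈⟨ +-congˡ (*-congˡ (eval-horner r x d ds)) ⟩
    c + x * (e + (x - r) * t)    ≈⟨ solve 5 (λ r x c e t → c :+ x :* (e :+ (x :- r) :* t) :=
                                      c :+ r :* e :+ (x :- r) :* (e :+ x :* t)) refl r x c e t ⟩
    c + r * e + (x - r) * (e + x * t) ∎
    where
    e = eval (d ∷ ds) r
    t = eval (horner r ds) x

  leading-horner : ∀ {n} r (cs : Vec Carrier (suc n)) → leading (horner r cs) ≈ leading cs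
  leading-horner r (c ∷ [])     = trans (+-congˡ (zeroʳ r)) (+-identityʳ c)
  leading-horner r (_ ∷ d ∷ cs) = leading-horner r (d ∷ cs)

  -- Dividing by X - r₀ lowers the degree and keeps the leading coefficient; the remaining roots
  -- differ from r₀ and hence are roots of the quotient.
  too-many-roots : ∀ {n} (cs : Vec Carrier (suc n)) → leading cs ≉ 0# →
                   (r : Fin (suc n) → Carrier) → (∀ {i j} → r i ≈ r j → i ≡ j) →
                   ¬ (∀ i → eval cs (r i) ≈ 0#)
  too-many-roots (c ∷ []) c≉0 r r-injective root =
    c≉0 (trans (sym (trans (+-congˡ (zeroʳ _)) (+-identityʳ c))) (root zero))
  too-many-roots (c ∷ cs@(_ ∷ _)) lead≉0 r r-injective root =
    too-many-roots (horner r₀ cs) (lead≉0 ∘ trans (sym (leading-horner r₀ cs)))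
      (r ∘ suc) (λ eq → Fin.suc-injective (r-injective eq)) quotient-root
    where
    r₀ = r zero
    quotient-root : ∀ i → eval (horner r₀ cs) (r (suc i)) ≈ 0#
    quotient-root i = x≉0∧xy≈0⇒y≈0 (λ x-r≈0 → Fin.0≢1+n (≡.sym (r-injective (x-y≈0⇒x≈y _ _ x-r≈0)))) (begin
      (x - r₀) * eval (horner r₀ cs) x        ≈⟨ +-identityˡ _ ⟨
      0# + (x - r₀) * eval (horner r₀ cs) x   ≈⟨ +-congʳ (root zero) ⟨
      eval (c ∷ cs) r₀ + (x - r₀) * eval (horner r₀ cs) x ≈⟨ eval-horner r₀ x c cs ⟨
      eval (c ∷ cs) x                         ≈⟨ root (suc i) ⟩
      0#                                      ∎)
      where x = r (suc i)

  monomial : ∀ n → Vec Carrier (suc n)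
  monomial zero    = 1# ∷ []
  monomial (suc n) = 0# ∷ monomial n

  leading-monomial : ∀ n → leading (monomial n) ≈ 1#
  leading-monomial zero          = refl
  leading-monomial (suc zero)    = refl
  leading-monomial (suc (suc n)) = leading-monomial (suc n)

  eval-monomial : ∀ n x → eval (monomial n) x ≈ x ^ n
  eval-monomial zero    x = trans (+-congˡ (zeroʳ x)) (+-identityʳ 1#)
  eval-monomial (suc n) x = trans (+-identityˡ _) (*-congˡ (eval-monomial n x))

  -- Fixed points are roots of X^n - X, encoded as `0# ∷ - 1# ∷ monomial m` with n = m + 2. For n =
  -- 1 this polynomial would be zero.
  too-many-fixed-points-of-^ : ∀ n → 1 ℕ.< n → (r : Fin (suc n) → Carrier) → (∀ {i j} → r i ≈ r j → i ≡ j) →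
                          ¬ (∀ i → r i ^ n ≈ r i)
  too-many-fixed-points-of-^ (suc zero) (ℕ.s≤s ())
  too-many-fixed-points-of-^ (suc (suc m)) _ r r-injective fixed =
    too-many-roots (0# ∷ - 1# ∷ monomial m) (λ lead≈0 → 1≉0 (trans (sym (lead m)) lead≈0)) r r-injective
      (λ i → trans (eval≈ (r i)) (trans (+-congʳ (fixed i)) (-‿inverseʳ (r i))))
    where
    lead : ∀ m → leading (0# ∷ - 1# ∷ monomial m) ≈ 1#
    lead zero    = refl
    lead (suc m) = leading-monomial (suc m)
    eval≈ : ∀ x → eval (0# ∷ - 1# ∷ monomial m) x ≈ x ^ suc (suc m) - x
    eval≈ x = begin
      0# + x * (- 1# + x * eval (monomial m) x)  ≈⟨ +-congˡ (*-congˡ (+-congˡ (*-congˡ (eval-monomial m x)))) ⟩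
      0# + x * (- 1# + x * x ^ m)             ≈⟨ solve 2 (λ x y → :num 0 :+ x :* (:- :num 1 :+ x :* y) :=
                                                   x :* (x :* y) :- x) refl x (x ^ m) ⟩
      x ^ suc (suc m) - x                     ∎

-- Identities modulo a hypothesis

module Relations {c ℓ} (R : CommutativeRing c ℓ) where
  open CommutativeRing R
  open GroupProperties +-group using () renaming (x≈y⇒x∙y⁻¹≈ε to x≈y⇒x-y≈0)

  -- Reduces a consequence of one equation to a ring identity: with the cofactor `k` supplied, the
  -- last argument is left to the solver.
  modulo : ∀ {x y a b} k → a ≈ b → x ≈ y + k * (a - b) → x ≈ y
  modulo {y = y} k a≈b x≈y+k[a-b] = trans x≈y+k[a-b]
    (trans (+-congˡ (trans (*-congˡ (x≈y⇒x-y≈0 a≈b)) (zeroʳ k))) (+-identityʳ y))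

-- Points on W² = T³ + ν and the equation in s and u

module MordellCurve {c ℓ} (F : Field c ℓ) {n : ℕ} (order : HasOrder F n)
  (2≉0 : ¬ Field._≈_ F (IntegerCoefficients.num (Field.commutativeRing F) 2) (Field.0# F))
  (3≉0 : ¬ Field._≈_ F (IntegerCoefficients.num (Field.commutativeRing F) 3) (Field.0# F))
  where
  open Field F hiding (zero)
  open FieldProperties F
  open FiniteFieldProperties F order
  open Squares F order
  open Relations commutativeRing
  open IntegerCoefficients commutativeRing using (num; num-*; solve; _:=_; _:+_; _:*_; _:-_; :-_; :num)
  open SetoidReasoning setoid

  4≉0 : num 4 ≉ 0#
  4≉0 4≈0 = *-≉0 2≉0 2≉0 (trans (sym (num-* 2 2)) 4≈0)

  6≉0 : num 6 ≉ 0#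
  6≉0 6≈0 = *-≉0 2≉0 3≉0 (trans (sym (num-* 2 3)) 6≈0)

  module _ (ν : Carrier) where

    cubic : Carrier → Carrier
    cubic x = x * x * x + ν

    -- Shallue and van de Woestijne: a point on y²(1 + v + v²) = - cubic 1 makes the product of
    -- cubic at v, - 1 - v and 1 + y² a square.
    module _ {y v} (conic : y * y * (num 1 + v + v * v) ≈ - (num 1 + ν)) where
      private
        h = num 1 + v + v * v
        P = (y * y + num 1 - v) * (y * y + num 2 + v)

      -- Write `cubic T` as (T - 1)(T² + T + 1) + (1 + ν). The factor T² + T + 1 is `h` at both v
      -- and - 1 - v, and the conic replaces 1 + ν by - y² h, so `h` divides both values.
      cubic[v]*cubic[-1-v] : cubic v * cubic (- num 1 - v) ≈ h * h * P
      cubic[v]*cubic[-1-v] = begin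
        cubic v * cubic (- num 1 - v)                  ≈⟨ *-cong (modulo (num 1) conic
          (solve 3 (λ ν y v → v :* v :* v :+ ν := (:num 1 :+ v :+ v :* v) :* (v :- :num 1 :- y :* y)
            :+ :num 1 :* (y :* y :* (:num 1 :+ v :+ v :* v) :- :- (:num 1 :+ ν))) refl ν y v))
                                                                 (modulo (num 1) conic
          (solve 3 (λ ν y v → (:- :num 1 :- v) :* (:- :num 1 :- v) :* (:- :num 1 :- v) :+ ν
            := (:- (:num 1 :+ v :+ v :* v)) :* (y :* y :+ :num 2 :+ v)
            :+ :num 1 :* (y :* y :* (:num 1 :+ v :+ v :* v) :- :- (:num 1 :+ ν))) refl ν y v)) ⟩
        (h * (v - num 1 - y * y)) * ((- h) * (y * y + num 2 + v)) ≈⟨ solve 3 (λ h y v →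
          (h :* (v :- :num 1 :- y :* y)) :* ((:- h) :* (y :* y :+ :num 2 :+ v)) :=
          h :* h :* ((y :* y :+ :num 1 :- v) :* (y :* y :+ :num 2 :+ v))) refl h y v ⟩
        h * h * P ∎

      -- At T = 1 + y² the difference T³ - 1 is y² (y⁴ + 3y² + 3); subtracting y² h leaves y² P.
      cubic[1+y²] : cubic (num 1 + y * y) ≈ y * y * P
      cubic[1+y²] = modulo (num 1) conic
        (solve 3 (λ ν y v → (:num 1 :+ y :* y) :* (:num 1 :+ y :* y) :* (:num 1 :+ y :* y) :+ ν
            := y :* y :* ((y :* y :+ :num 1 :- v) :* (y :* y :+ :num 2 :+ v))
            :+ :num 1 :* (y :* y :* (:num 1 :+ v :+ v :* v) :- :- (:num 1 :+ ν))) refl ν y v)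

      -- If the values at v and - 1 - v are nonsquares, their product h² P is a square, hence so are
      -- P and y² P. That h is nonzero follows from 1 + ν ≠ 0 through the conic.
      cubic-square : y ≉ 0# → num 1 + ν ≉ 0# → ∃ λ x → Square (cubic x)
      cubic-square y≉0 1+ν≉0 with square? (cubic (num 1 + y * y)) | square? (cubic v) | square? (cubic (- num 1 - v))
      ... | yes sq | _      | _      = num 1 + y * y , sq
      ... | no  _  | yes sq | _      = v , sq
      ... | no  _  | no  _  | yes sq = - num 1 - v , sq
      ... | no ¬sq₁ | no ¬sq₂ | no ¬sq₃ = contradiction
        (Square-resp-≈ (sym cubic[1+y²]) (Square-* (y , refl)
          (Square-cancel-* h h≉0 (sym cubic[v]*cubic[-1-v]) (nonsquare-*-nonsquare ¬sq₂ ¬sq₃)))) ¬sq₁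
        where
        h≉0 : h ≉ 0#
        h≉0 = factorʳ-≉0 {y * y} (λ y²h≈0 → -‿≉0 1+ν≉0 (trans (sym conic) y²h≈0))

    cubic-has-square-value : Square (- num 3) → ∃ λ x → Square (cubic x)
    cubic-has-square-value (e , e²≈-3) with ν + num 2 ≟ 0# | num 1 + ν ≟ 0#
    -- The exceptional values of ν, where `y` or the right side of the conic would vanish, are
    -- served by 3³ - 2 = 5² and 1³ - 1 = 0².
    ... | yes ν+2≈0 | _ = num 3 , num 5 , modulo (- num 1) ν+2≈0
            (solve 1 (λ ν → :num 5 :* :num 5 := :num 3 :* :num 3 :* :num 3 :+ ν
              :+ (:- :num 1) :* (ν :+ :num 2 :- :num 0)) refl ν)
    ... | no _ | yes 1+ν≈0 = num 1 , num 0 , modulo (- num 1) 1+ν≈0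
            (solve 1 (λ ν → :num 0 :* :num 0 := :num 1 :* :num 1 :* :num 1 :+ ν
              :+ (:- :num 1) :* (:num 1 :+ ν :- :num 0)) refl ν)
    ... | no ν+2≉0 | no 1+ν≉0 = cubic-square conic y≉0 1+ν≉0
      where
      e≉0 : e ≉ 0#
      e≉0 = factorˡ-≉0 (λ e²≈0 → -‿≉0 3≉0 (trans (sym e²≈-3) e²≈0))
      e⁻¹ = recip e e≉0
      -- Since e² = - 3, four times the conic reads (y (1 + 2v))² - (e y)² = - 4 (1 + ν). The right
      -- side is ν² - (ν + 2)², which suggests y (1 + 2v) = - ν and e y = ν + 2.
      y = (ν + num 2) * e⁻¹
      y≉0 : y ≉ 0#
      y≉0 = *-≉0 ν+2≉0 (recip-≉0 e e≉0)
      y⁻¹ = recip y y≉0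
      ½ = recip (num 2) 2≉0
      v = (- (ν * y⁻¹) - num 1) * ½
      1+2v≈-ν/y : num 1 + num 2 * v ≈ - (ν * y⁻¹)
      1+2v≈-ν/y = modulo (- (ν * y⁻¹) - num 1) (recip-inverseʳ (num 2) 2≉0)
        (solve 2 (λ a h → :num 1 :+ :num 2 :* ((:- a :- :num 1) :* h) := :- a
          :+ (:- a :- :num 1) :* (:num 2 :* h :- :num 1)) refl (ν * y⁻¹) ½)
      y[1+2v]≈-ν : y * (num 1 + num 2 * v) ≈ - ν
      y[1+2v]≈-ν = trans (*-congˡ 1+2v≈-ν/y) (modulo (- ν) (recip-inverseʳ y y≉0)
        (solve 3 (λ ν y i → y :* (:- (ν :* i)) := :- ν :+ (:- ν) :* (y :* i :- :num 1)) refl ν y y⁻¹))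
      ey≈ν+2 : e * y ≈ ν + num 2
      ey≈ν+2 = modulo (ν + num 2) (recip-inverseʳ e e≉0)
        (solve 3 (λ ν e i → e :* ((ν :+ :num 2) :* i) := ν :+ :num 2 :+ (ν :+ :num 2) :* (e :* i :- :num 1)) refl ν e e⁻¹)
      conic : y * y * (num 1 + v + v * v) ≈ - (num 1 + ν)
      conic = *-cancelˡ-≉0 4≉0 (begin
        num 4 * (y * y * (num 1 + v + v * v))
          ≈⟨ solve 2 (λ y v → :num 4 :* (y :* y :* (:num 1 :+ v :+ v :* v)) :=
               (y :* (:num 1 :+ :num 2 :* v)) :* (y :* (:num 1 :+ :num 2 :* v)) :- y :* y :* (:- :num 3)) refl y v ⟩
        (y * (num 1 + num 2 * v)) * (y * (num 1 + num 2 * v)) - y * y * (- num 3)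
          ≈⟨ +-cong (*-cong y[1+2v]≈-ν y[1+2v]≈-ν) (-‿cong (*-congˡ (sym e²≈-3))) ⟩
        (- ν) * (- ν) - y * y * (e * e)
          ≈⟨ +-congˡ (-‿cong (solve 2 (λ y e → y :* y :* (e :* e) := (e :* y) :* (e :* y)) refl y e)) ⟩
        (- ν) * (- ν) - (e * y) * (e * y)
          ≈⟨ +-congˡ (-‿cong (*-cong ey≈ν+2 ey≈ν+2)) ⟩
        (- ν) * (- ν) - (ν + num 2) * (ν + num 2)
          ≈⟨ solve 1 (λ ν → (:- ν) :* (:- ν) :- (ν :+ :num 2) :* (ν :+ :num 2) := :num 4 :* (:- (:num 1 :+ ν))) refl ν ⟩
        num 4 * (- (num 1 + ν)) ∎)

  -- For x ≠ y the cofactor x² + x y + y² vanishes, that is, (2x + y)² = - 3 y². Unless y = 0, this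
  -- makes - 3 a square.
  cube-injective : ¬ Square (- num 3) → ∀ {x y} → x * x * x ≈ y * y * y → x ≈ y
  cube-injective ¬Square[-3] {x} {y} x³≈y³ with xy≈0⇒x≈0⊎y≈0 {x - y} {x * x + x * y + y * y}
    (modulo (num 1) x³≈y³ (solve 2 (λ x y → (x :- y) :* (x :* x :+ x :* y :+ y :* y) := :num 0
      :+ :num 1 :* (x :* x :* x :- y :* y :* y)) refl x y))
  ... | inj₁ x-y≈0 = x-y≈0⇒x≈y x y x-y≈0
  ... | inj₂ x²+xy+y²≈0 with y ≟ 0#
  ... | no  y≉0 = contradiction (Square-cancel-* y y≉0 (modulo (- num 4) x²+xy+y²≈0
          (solve 2 (λ x y → y :* y :* (:- :num 3) := (:num 2 :* x :+ y) :* (:num 2 :* x :+ y)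
            :+ (:- :num 4) :* (x :* x :+ x :* y :+ y :* y :- :num 0)) refl x y)) (num 2 * x + y , refl)) ¬Square[-3]
  ... | yes y≈0 with xy≈0⇒x≈0⊎y≈0 {x} {x} (begin
          x * x                                  ≈⟨ modulo (- (x + y)) y≈0 (solve 2 (λ x y → x :* x := x :* x :+ x :* y :+ y :* y
                                                      :+ (:- (x :+ y)) :* (y :- :num 0)) refl x y) ⟩
          x * x + x * y + y * y                  ≈⟨ x²+xy+y²≈0 ⟩
          0#                                     ∎)
  ... | inj₁ x≈0 = trans x≈0 (sym y≈0)
  ... | inj₂ x≈0 = trans x≈0 (sym y≈0)

  module _ (D : Carrier) (¬Square[D] : ¬ Square D) where

    private
      D≉0 : D ≉ 0#
      D≉0 D≈0 = ¬Square[D] (0# , trans (zeroˡ 0#) (sym D≈0))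

      d = recip D D≉0
      Dd≈1 = recip-inverseʳ D D≉0

      Solution : Set (c Level.⊔ ℓ)
      Solution = ∃₂ λ s u → num 12 * D * s * (u * u) + num 4 * (D * D) * (s * s * s) ≈ - num 1

      solution-if-¬Square[-3] : ¬ Square (- num 3) → Solution
      solution-if-¬Square[-3] ¬Square[-3] with injective⇒surjective (cube-injective ¬Square[-3])
        (- (d * d * recip (num 4) 4≉0))
      ... | s , s³≈-1/4D² = s , 0# , (begin
        num 12 * D * s * (0# * 0#) + num 4 * (D * D) * (s * s * s)
          ≈⟨ +-congˡ (*-congˡ s³≈-1/4D²) ⟩
        num 12 * D * s * (0# * 0#) + num 4 * (D * D) * (- (d * d * ¼))
          ≈⟨ solve 4 (λ D d s q → :num 12 :* D :* s :* (:num 0 :* :num 0) :+ :num 4 :* (D :* D) :* (:- (d :* d :* q))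
               := :- ((D :* d) :* (D :* d) :* (:num 4 :* q))) refl D d s ¼ ⟩
        - ((D * d) * (D * d) * (num 4 * ¼))
          ≈⟨ -‿cong (*-cong (*-cong Dd≈1 Dd≈1) (recip-inverseʳ (num 4) 4≉0)) ⟩
        - (1# * 1# * 1#)
          ≈⟨ solve 0 (:- (:num 1 :* :num 1 :* :num 1) := :- :num 1) refl ⟩
        - num 1 ∎)
        where ¼ = recip (num 4) 4≉0

      solution-if-Square[-3] : Square (- num 3) → Solution
      solution-if-Square[-3] (e , e²≈-3) with cubic-has-square-value (num 4 * d) (e , e²≈-3)
      -- With s = 1/(D T), multiplying the equation by T³ gives T³ + 4/D = - 3 (2 u T)² = (2 e u
      -- T)². Solving W = ± 2 e u T for u, with 1/e = - e/3, yields the witness up to sign.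
      ... | T , W , W²≈T³+4d = d * τ , e * W * τ * κ , (begin
        num 12 * D * (d * τ) * ((e * W * τ * κ) * (e * W * τ * κ)) + num 4 * (D * D) * ((d * τ) * (d * τ) * (d * τ))
          ≈⟨ solve 6 (λ D d τ κ e W → :num 12 :* D :* (d :* τ) :* ((e :* W :* τ :* κ) :* (e :* W :* τ :* κ))
                 :+ :num 4 :* (D :* D) :* ((d :* τ) :* (d :* τ) :* (d :* τ))
               := :num 12 :* (D :* d) :* (κ :* κ) :* (τ :* τ :* τ) :* (e :* e) :* (W :* W)
                 :+ :num 4 :* (D :* d) :* (D :* d) :* d :* (τ :* τ :* τ)) refl D d τ κ e W ⟩
        num 12 * (D * d) * (κ * κ) * (τ * τ * τ) * (e * e) * (W * W) + num 4 * (D * d) * (D * d) * d * (τ * τ * τ)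
          ≈⟨ +-cong (*-cong (*-cong (*-congʳ (*-congʳ (*-congˡ Dd≈1))) e²≈-3) W²≈T³+4d)
                    (*-congʳ (*-congʳ (*-cong (*-congˡ Dd≈1) Dd≈1))) ⟩
        num 12 * 1# * (κ * κ) * (τ * τ * τ) * (- num 3) * (T * T * T + num 4 * d) + num 4 * 1# * 1# * d * (τ * τ * τ)
          ≈⟨ solve 4 (λ d τ κ T → :num 12 :* :num 1 :* (κ :* κ) :* (τ :* τ :* τ) :* (:- :num 3) :* (T :* T :* T :+ :num 4 :* d)
                 :+ :num 4 :* :num 1 :* :num 1 :* d :* (τ :* τ :* τ)
               := :- ((:num 6 :* κ) :* (:num 6 :* κ) :* ((T :* τ) :* (T :* τ) :* (T :* τ) :+ :num 4 :* d :* (τ :* τ :* τ)))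
                 :+ :num 4 :* d :* (τ :* τ :* τ)) refl d τ κ T ⟩
        - ((num 6 * κ) * (num 6 * κ) * ((T * τ) * (T * τ) * (T * τ) + num 4 * d * (τ * τ * τ))) + num 4 * d * (τ * τ * τ)
          ≈⟨ +-congʳ (-‿cong (*-cong (*-cong 6κ≈1 6κ≈1) (+-congʳ (*-cong (*-cong Tτ≈1 Tτ≈1) Tτ≈1)))) ⟩
        - (1# * 1# * (1# * 1# * 1# + num 4 * d * (τ * τ * τ))) + num 4 * d * (τ * τ * τ)
          ≈⟨ solve 1 (λ x → :- (:num 1 :* :num 1 :* (:num 1 :* :num 1 :* :num 1 :+ x)) :+ x := :- :num 1) refl
               (num 4 * d * (τ * τ * τ)) ⟩
        - num 1 ∎)
        where
        -- If T = 0, then W² = 4/D, so 4 D = (D W)² and D would be a square.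
        T≉0 : T ≉ 0#
        T≉0 T≈0 = ¬Square[D] (Square-cancel-* (num 2) 2≉0 (begin
          (num 2 * num 2) * D            ≈⟨ solve 1 (λ D → :num 2 :* :num 2 :* D := :num 4 :* :num 1 :* D) refl D ⟩
          num 4 * 1# * D                 ≈⟨ *-congʳ (*-congˡ Dd≈1) ⟨
          num 4 * (D * d) * D            ≈⟨ solve 2 (λ D d → :num 4 :* (D :* d) :* D := D :* D :* (:num 0 :* :num 0 :* :num 0 :+ :num 4 :* d)) refl D d ⟩
          D * D * (0# * 0# * 0# + num 4 * d) ≈⟨ *-congˡ (+-congʳ (*-cong (*-cong T≈0 T≈0) T≈0)) ⟨
          D * D * (T * T * T + num 4 * d) ≈⟨ *-congˡ W²≈T³+4d ⟨
          D * D * (W * W)                ∎) (Square-* (D , refl) (W , refl)))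
        τ = recip T T≉0
        Tτ≈1 = recip-inverseʳ T T≉0
        κ = recip (num 6) 6≉0
        6κ≈1 = recip-inverseʳ (num 6) 6≉0

    quartic-solution : Solution
    quartic-solution with square? (- num 3)
    ... | yes sq = solution-if-Square[-3] sq
    ... | no ¬sq = solution-if-¬Square[-3] ¬sq

-- Prime characteristic

module Characteristic {c ℓ} (F : Field c ℓ) where
  open Field F hiding (zero)
  open FieldProperties F
  open SemiringMult semiring using (×1-homo-*) renaming (_×_ to _·_)
  open SetoidReasoning setoid

  private
    ∣⇒·1≈0 : ∀ {r m} → r · 1# ≈ 0# → r ∣ m → m · 1# ≈ 0#
    ∣⇒·1≈0 {r} r·1≈0 (divides k ≡.refl) = trans (×1-homo-* k r) (trans (*-congˡ r·1≈0) (zeroʳ _))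

    bézout : ∀ {r m} x y → r · 1# ≈ 0# → m · 1# ≈ 0# → ¬ 1 ℕ.+ y ℕ.* m ≡ x ℕ.* r
    bézout {r} {m} x y r·1≈0 m·1≈0 eq = 1≉0 (begin
      1#                     ≈⟨ +-identityʳ 1# ⟨
      1# + 0#                ≈⟨ +-congˡ (∣⇒·1≈0 m·1≈0 (divides y ≡.refl)) ⟨
      (1 ℕ.+ y ℕ.* m) · 1#   ≡⟨ ≡.cong (_· 1#) eq ⟩
      (x ℕ.* r) · 1#         ≈⟨ ∣⇒·1≈0 r·1≈0 (divides x ≡.refl) ⟩
      0#                     ∎)

  -- If r did not divide m, a Bézout relation between r and m would give 1 = 0.
  prime-characteristic : ∀ {r} → Prime r → r · 1# ≈ 0# → HasCharacteristic F r
  prime-characteristic {r} r-prime r·1≈0 m = mk⇔ ·1≈0⇒∣ (∣⇒·1≈0 r·1≈0)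
    where
    ·1≈0⇒∣ : m · 1# ≈ 0# → r ∣ m
    ·1≈0⇒∣ m·1≈0 with r ∣? m
    ... | yes r∣m = r∣m
    ... | no  r∤m with coprime-Bézout {r} {m} coprime
      where
      coprime : Coprime r m
      coprime (d∣r , d∣m) with prime⇒irreducible r-prime d∣r
      ... | inj₁ d≡1    = d≡1
      ... | inj₂ ≡.refl = contradiction d∣m r∤m
    ... | Bézout.+- x y eq = contradiction eq (bézout x y r·1≈0 m·1≈0)
    ... | Bézout.-+ x y eq = contradiction eq (bézout y x m·1≈0 r·1≈0)

-- Conjugation x ↦ x^q, fixed and skew elements

module QuadraticExtension {c₁ ℓ₁ c₂ ℓ₂} {p k : ℕ} (p-prime : Prime p)
  (2∤q : 2 ∤ p ℕ.^ suc k)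
  (K : Field c₁ ℓ₁) (K-order : HasOrder K (p ℕ.^ suc k))
  (L : Field c₂ ℓ₂) (L-order : HasOrder L (p ℕ.^ suc k ℕ.* p ℕ.^ suc k))
  (emb : Embedding K L) where

  private
    q = p ℕ.^ suc k
    module K = Field K
    module KNum = IntegerCoefficients K.commutativeRing
    module KFinite = FiniteFieldProperties K K-order
    module KOrder = Inverse K-order
    module LOrder = Inverse L-order
  open Field L hiding (zero)
  open FieldProperties L
  open FiniteFieldProperties L L-order
  open Relations commutativeRing
  open IntegerCoefficients commutativeRing
    using (num; num-suc; ·1≈num; solve; _:=_; _:+_; _:*_; _:-_; :-_; :num; _:^_)
  open CommutativeSemiringExp commutativeSemiring using (_^_; ^-congˡ; ^-homo-*; ^-assocʳ; ^-distrib-*)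
  open SemiringMult semiring using (×1-homo-*) renaming (_×_ to _·_)
  open GroupProperties +-group using (inverseˡ-unique; identityˡ-unique)
  open Embedding emb
  open IsRingMonomorphism isRingMonomorphism
    using (+-homo; *-homo; -‿homo; 0#-homo; 1#-homo; ⟦⟧-cong) renaming (injective to ι-injective)
  open SetoidReasoning setoid

  1<q : 1 ℕ.< q
  1<q = lemma (KOrder.to K.0#) (KOrder.to K.1#) (λ eq → K.1≉0 (K.sym (KFinite.to-injective eq)))
    where
    lemma : ∀ {n} (i j : Fin n) → i ≡.≢ j → 1 ℕ.< n
    lemma {suc zero}    zero zero i≢j = contradiction ≡.refl i≢j
    lemma {suc (suc n)} _    _    _   = ℕ.s<s ℕ.z<s

  private
    ^·1≈0 : ∀ m j → (m ℕ.^ j) · 1# ≈ 0# → m · 1# ≈ 0#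
    ^·1≈0 m zero    1·1≈0 = contradiction (trans (sym (+-identityʳ 1#)) 1·1≈0) 1≉0
    ^·1≈0 m (suc j) mm^j·1≈0 with xy≈0⇒x≈0⊎y≈0 (trans (sym (×1-homo-* m (m ℕ.^ j))) mm^j·1≈0)
    ... | inj₁ m·1≈0   = m·1≈0
    ... | inj₂ m^j·1≈0 = ^·1≈0 m j m^j·1≈0

  -- The order q² of `L` annihilates `1#`, and q² · 1 is the square of q · 1.
  q·1≈0 : q · 1# ≈ 0#
  q·1≈0 with xy≈0⇒x≈0⊎y≈0 (trans (sym (×1-homo-* q q)) order·1≈0)
  ... | inj₁ q·1≈0 = q·1≈0
  ... | inj₂ q·1≈0 = q·1≈0

  open Frobenius commutativeRing p-prime using (frobenius-^-+)

  -- Otherwise the characteristic would be 2, and q · 1 = 0 would make q even.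
  2≉0 : num 2 ≉ 0#
  2≉0 2≈0 = 2∤q (Equivalence.to (Characteristic.prime-characteristic L prime[2] (trans (·1≈num 2) 2≈0) q) q·1≈0)

  conj : Carrier → Carrier
  conj x = x ^ q

  Fixed Skew : Carrier → Set ℓ₂
  Fixed x = conj x ≈ x
  Skew  x = conj x ≈ - x

  conj-cong : ∀ {x y} → x ≈ y → conj x ≈ conj y
  conj-cong = ^-congˡ q

  conj-+ : ∀ x y → conj (x + y) ≈ conj x + conj y
  conj-+ = frobenius-^-+ (^·1≈0 p (suc k) q·1≈0) (suc k)

  conj-* : ∀ x y → conj (x * y) ≈ conj x * conj y
  conj-* x y = ^-distrib-* x y q

  conj-involutive : ∀ x → conj (conj x) ≈ x
  conj-involutive x = trans (^-assocʳ x q q) (LittleFermat.x^n≈x L L-order x)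

  conj-0 : conj 0# ≈ 0#
  conj-0 = identityˡ-unique (conj 0#) (conj 0#)
    (trans (sym (conj-+ 0# 0#)) (conj-cong (+-identityˡ 0#)))

  conj-1 : conj 1# ≈ 1#
  conj-1 = 1^n≈1 q
    where
    1^n≈1 : ∀ n → 1# ^ n ≈ 1#
    1^n≈1 zero    = refl
    1^n≈1 (suc n) = trans (*-identityˡ _) (1^n≈1 n)

  conj-neg : ∀ x → conj (- x) ≈ - conj x
  conj-neg x = inverseˡ-unique (conj (- x)) (conj x)
    (trans (sym (conj-+ (- x) x)) (trans (conj-cong (-‿inverseˡ x)) conj-0))

  conj-sub : ∀ x y → conj (x - y) ≈ conj x - conj y
  conj-sub x y = trans (conj-+ x (- y)) (+-congˡ (conj-neg y))

  conj-^ : ∀ x n → conj (x ^ n) ≈ conj x ^ n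
  conj-^ x zero    = conj-1
  conj-^ x (suc n) = trans (conj-* x (x ^ n)) (*-congˡ (conj-^ x n))

  Fixed-resp : ∀ {x y} → x ≈ y → Fixed y → Fixed x
  Fixed-resp x≈y fy = trans (conj-cong x≈y) (trans fy (sym x≈y))

  Fixed-+ : ∀ {x y} → Fixed x → Fixed y → Fixed (x + y)
  Fixed-+ fx fy = trans (conj-+ _ _) (+-cong fx fy)

  Fixed-* : ∀ {x y} → Fixed x → Fixed y → Fixed (x * y)
  Fixed-* fx fy = trans (conj-* _ _) (*-cong fx fy)

  Fixed-neg : ∀ {x} → Fixed x → Fixed (- x)
  Fixed-neg fx = trans (conj-neg _) (-‿cong fx)

  Fixed-num : ∀ n → Fixed (num n)
  Fixed-num zero    = conj-0
  Fixed-num (suc n) = Fixed-resp (num-suc n) (Fixed-+ conj-1 (Fixed-num n))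

  conj-recip : ∀ {x y} (x≉0 : x ≉ 0#) → conj x ≈ y → y * conj (recip x x≉0) ≈ 1#
  conj-recip {x} {y} x≉0 x̄≈y = begin
    y * conj (recip x x≉0)       ≈⟨ *-congʳ x̄≈y ⟨
    conj x * conj (recip x x≉0)  ≈⟨ conj-* x _ ⟨
    conj (x * recip x x≉0)       ≈⟨ conj-cong (recip-inverseʳ x x≉0) ⟩
    conj 1#                      ≈⟨ conj-1 ⟩
    1#                           ∎

  Fixed-recip : ∀ {x} (x≉0 : x ≉ 0#) → Fixed x → Fixed (recip x x≉0)
  Fixed-recip {x} x≉0 fx = *-cancelˡ-≉0 x≉0 (trans (conj-recip x≉0 fx) (sym (recip-inverseʳ x x≉0)))

  Skew-recip : ∀ {x} (x≉0 : x ≉ 0#) → Skew x → Skew (recip x x≉0)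
  Skew-recip {x} x≉0 sx = *-cancelˡ-≉0 (-‿≉0 x≉0) (begin
    - x * conj (recip x x≉0)  ≈⟨ conj-recip x≉0 sx ⟩
    1#                        ≈⟨ recip-inverseʳ x x≉0 ⟨
    x * recip x x≉0           ≈⟨ solve 2 (λ x r → x :* r := :- x :* :- r) refl x _ ⟩
    - x * - recip x x≉0       ∎)

  Skew-sub : ∀ x → Skew (x - conj x)
  Skew-sub x = begin
    conj (x - conj x)         ≈⟨ conj-sub x (conj x) ⟩
    conj x - conj (conj x)    ≈⟨ +-congˡ (-‿cong (conj-involutive x)) ⟩
    conj x - x                ≈⟨ solve 2 (λ x y → y :- x := :- (x :- y)) refl x (conj x) ⟩
    - (x - conj x)            ∎

  Fixed-*-Skew : ∀ {x y} → Fixed x → Skew y → Skew (x * y)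
  Fixed-*-Skew fx sy = trans (conj-* _ _) (trans (*-cong fx sy)
    (solve 2 (λ x y → x :* :- y := :- (x :* y)) refl _ _))

  Fixed-square : ∀ {x} → Skew x → Fixed (x * x)
  Fixed-square sx = trans (conj-* _ _) (trans (*-cong sx sx)
    (solve 1 (λ x → :- x :* :- x := x :* x) refl _))

  Skew∧Fixed⇒≈0 : ∀ {x} → Skew x → Fixed x → x ≈ 0#
  Skew∧Fixed⇒≈0 {x} sx fx = x≉0∧xy≈0⇒y≈0 2≉0 (begin
    num 2 * x   ≈⟨ solve 1 (λ x → :num 2 :* x := x :- :- x) refl x ⟩
    x - - x     ≈⟨ +-congˡ (-‿cong (trans (sym sx) fx)) ⟩
    x - x       ≈⟨ -‿inverseʳ x ⟩
    0#          ∎)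

  ι-^ : ∀ a n → ι (SemiringExp._^_ K.semiring a n) ≈ ι a ^ n
  ι-^ a zero    = 1#-homo
  ι-^ a (suc n) = trans (*-homo a _) (*-congˡ (ι-^ a n))

  ι-num : ∀ n → ι (KNum.num n) ≈ num n
  ι-num zero    = 0#-homo
  ι-num (suc n) = trans (⟦⟧-cong (KNum.num-suc n)) (trans (+-homo _ _)
    (trans (+-cong 1#-homo (ι-num n)) (sym (num-suc n))))

  ι-fixed : ∀ a → Fixed (ι a)
  ι-fixed a = trans (sym (ι-^ a q)) (⟦⟧-cong (LittleFermat.x^n≈x K K-order a))

  InSubfield⇒Fixed : ∀ {x} → InSubfield x → Fixed x
  InSubfield⇒Fixed (a , ιa≈x) = Fixed-resp (sym ιa≈x) (ι-fixed a)

  -- A fixed element outside the image of `ι`, together with the q elements of that image, would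
  -- give q + 1 roots of X^q - X.
  Fixed⇒InSubfield : ∀ {x} → Fixed x → InSubfield x
  Fixed⇒InSubfield {x} fx with Fin.any? (λ i → ι (KOrder.from i) ≟ x)
  ... | yes (i , eq) = KOrder.from i , eq
  ... | no  x∉K      = contradiction r-fixed (Roots.too-many-fixed-points-of-^ L q 1<q r (r-injective _ _))
    where
    r : Fin (suc q) → Carrier
    r zero    = x
    r (suc i) = ι (KOrder.from i)
    r-injective : ∀ i j → r i ≈ r j → i ≡ j
    r-injective zero    zero    _  = ≡.refl
    r-injective zero    (suc j) eq = contradiction (j , sym eq) x∉K
    r-injective (suc i) zero    eq = contradiction (i , eq) x∉K
    r-injective (suc i) (suc j) eq = ≡.cong suc (≡.trans (≡.sym (KOrder.strictlyInverseˡ i))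
      (≡.trans (KOrder.to-cong (ι-injective eq)) (KOrder.strictlyInverseˡ j)))
    r-fixed : ∀ i → Fixed (r i)
    r-fixed zero    = fx
    r-fixed (suc i) = ι-fixed _

  -- The field `L` has q² ≥ q + 1 elements, too many for all of them to be roots of X^q - X.
  ∃-nonfixed : ∃ λ x → ¬ Fixed x
  ∃-nonfixed with Fin.any? (λ i → ¬? (conj (LOrder.from i) ≟ LOrder.from i))
  ... | yes (i , ¬fixed) = LOrder.from i , ¬fixed
  ... | no  all-fixed    = contradiction r-fixed (Roots.too-many-fixed-points-of-^ L q 1<q r r-injective)
    where
    1+q≤q*q : suc q ℕ.≤ q ℕ.* q
    1+q≤q*q = ℕ.m<m*n q q {{ℕ.>-nonZero (ℕ.<-trans ℕ.z<s 1<q)}} 1<q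
    r : Fin (suc q) → Carrier
    r i = LOrder.from (Fin.inject≤ i 1+q≤q*q)
    r-injective : ∀ {i j} → r i ≈ r j → i ≡ j
    r-injective eq = Fin.inject≤-injective 1+q≤q*q 1+q≤q*q _ _
      (≡.trans (≡.sym (LOrder.strictlyInverseˡ _)) (≡.trans (LOrder.to-cong eq) (LOrder.strictlyInverseˡ _)))
    r-fixed : ∀ i → Fixed (r i)
    r-fixed i = decidable-stable (conj (r i) ≟ r i) (λ ¬fixed → all-fixed (_ , ¬fixed))

  ∃-skew : ∃ λ ω → Skew ω × ω ≉ 0#
  ∃-skew with ∃-nonfixed
  ... | x , ¬fixed = x - conj x , Skew-sub x , λ eq → ¬fixed (sym (x-y≈0⇒x≈y _ _ eq))

  -- The trace map in terms of x and its conjugate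

  module TraceMap (γ : Carrier) where

    f : Carrier → Carrier
    f = traceMap L q γ

    -- The trace x⁴ - y x³ + y⁴ - x y³ with y = x̄ is (x - y)(x³ - y³), factored once more.
    quartic : Carrier → Carrier → Carrier
    quartic x y = (x - y) * (x - y) * (x * x + x * y + y * y)

    quartic-cong : ∀ {x y x′ y′} → x ≈ x′ → y ≈ y′ → quartic x y ≈ quartic x′ y′
    quartic-cong x≈x′ y≈y′ = *-cong (*-cong x-y x-y) (+-cong (+-cong (*-cong x≈x′ x≈x′) (*-cong x≈x′ y≈y′)) (*-cong y≈y′ y≈y′))
      where x-y = +-cong x≈x′ (-‿cong y≈y′)

    f-quartic : ∀ x → f x ≈ x + γ * quartic x (conj x)
    f-quartic x = +-congˡ (*-congˡ (begin
      (x ^ 4 - x ^ (q ℕ.+ 3)) + conj (x ^ 4 - x ^ (q ℕ.+ 3))  ≈⟨ +-cong z≈ conj-z≈ ⟩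
      (x ^ 4 - x̄ * x ^ 3) + (x̄ ^ 4 - x * x̄ ^ 3)
        ≈⟨ solve 2 (λ x y → x :^ 4 :- y :* x :^ 3 :+ (y :^ 4 :- x :* y :^ 3) :=
             (x :- y) :* (x :- y) :* (x :* x :+ x :* y :+ y :* y)) refl x x̄ ⟩
      quartic x x̄ ∎))
      where
      x̄ = conj x
      z≈ : x ^ 4 - x ^ (q ℕ.+ 3) ≈ x ^ 4 - x̄ * x ^ 3
      z≈ = +-congˡ (-‿cong (^-homo-* x q 3))
      conj-z≈ : conj (x ^ 4 - x ^ (q ℕ.+ 3)) ≈ x̄ ^ 4 - x * x̄ ^ 3
      conj-z≈ = begin
        conj (x ^ 4 - x ^ (q ℕ.+ 3))        ≈⟨ conj-cong z≈ ⟩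
        conj (x ^ 4 - x̄ * x ^ 3)            ≈⟨ conj-sub _ _ ⟩
        conj (x ^ 4) - conj (x̄ * x ^ 3)     ≈⟨ +-cong (conj-^ x 4) (-‿cong (trans (conj-* x̄ (x ^ 3))
                                                 (*-cong (conj-involutive x) (conj-^ x 3)))) ⟩
        x̄ ^ 4 - x * x̄ ^ 3                   ∎

    f-cong : ∀ {x y} → x ≈ y → f x ≈ f y
    f-cong x≈y = trans (f-quartic _) (trans
      (+-cong x≈y (*-congˡ (quartic-cong x≈y (conj-cong x≈y)))) (sym (f-quartic _)))

    f-fixed+skew : ∀ {u v} → Fixed u → Skew v →
                   f (u + v) ≈ u + v + γ * (num 4 * (v * v) * (num 3 * (u * u) + v * v))
    f-fixed+skew {u} {v} fu sv = trans (f-quartic (u + v)) (+-congˡ (*-congˡ (begin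
      quartic (u + v) (conj (u + v))  ≈⟨ quartic-cong refl (trans (conj-+ u v) (+-cong fu sv)) ⟩
      quartic (u + v) (u - v)         ≈⟨ solve 2 (λ u v → (u :+ v :- (u :- v)) :* (u :+ v :- (u :- v))
                                           :* ((u :+ v) :* (u :+ v) :+ (u :+ v) :* (u :- v) :+ (u :- v) :* (u :- v))
                                           := :num 4 :* (v :* v) :* (:num 3 :* (u :* u) :+ v :* v)) refl u v ⟩
      num 4 * (v * v) * (num 3 * (u * u) + v * v) ∎)))

    Collision : Set (c₂ Level.⊔ ℓ₂)
    Collision = ∃₂ λ x y → f x ≈ f y × x ≉ y

    Collision⇒¬IsPermutation : Collision → ¬ IsPermutation L f
    Collision⇒¬IsPermutation (x , y , fx≈fy , x≉y) (f-injective , _) = x≉y (f-injective fx≈fy)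

    mkPermutation : ∀ (g : Carrier → Carrier) → (∀ {x y} → f x ≈ f y → x ≈ y) → (∀ y → f (g y) ≈ y) → IsPermutation L f
    mkPermutation g f-injective fg≈id =
      f-injective , λ y → g y , λ z≈gy → trans (f-cong z≈gy) (fg≈id y)

    γ≈0⇒IsPermutation : γ ≈ 0# → IsPermutation L f
    γ≈0⇒IsPermutation γ≈0 = mkPermutation (λ y → y) (λ {x} {y} eq → trans (sym (f≈id x)) (trans eq (f≈id y))) f≈id
      where
      f≈id : ∀ x → f x ≈ x
      f≈id x = trans (+-congˡ (trans (*-congʳ γ≈0) (zeroˡ _))) (+-identityʳ x)

    -- Collisions when 3 is invertible

    module NotCharacteristic3 (3≉0 : num 3 ≉ 0#) where

      -- For fixed a the equation f (a + γ + ω) ≈ f (a + ω) is linear in a.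
      collision-fixed : γ ≉ 0# → Fixed γ → Collision
      collision-fixed γ≉0 fγ = a + γ + ω , a + ω , f[a+γ+ω]≈f[a+ω] ,
          λ eq → γ≉0 (modulo (num 1) eq (solve 3 (λ a γ ω → γ := :num 0 :+ :num 1 :* (a :+ γ :+ ω :- (a :+ ω))) refl a γ ω))
        where
        ω = proj₁ ∃-skew
        sω = proj₁ (proj₂ ∃-skew)
        ω≉0 = proj₂ (proj₂ ∃-skew)
        12ω²≉0 : num 3 * (num 2 * num 2) * (ω * ω) ≉ 0#
        12ω²≉0 = *-≉0 (*-≉0 3≉0 (*-≉0 2≉0 2≉0)) (*-≉0 ω≉0 ω≉0)
        2γ≉0 : num 2 * γ ≉ 0#
        2γ≉0 = *-≉0 2≉0 γ≉0
        i = recip _ 12ω²≉0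
        j = recip _ 2γ≉0
        -- The two values differ by γ (1 + 12 ω² (2 γ a + γ²)), so a has to satisfy 2 γ a + γ² = -
        -- 1/(12 ω²).
        a = (- i - γ * γ) * j
        fa : Fixed a
        fa = Fixed-* (Fixed-+ (Fixed-neg (Fixed-recip 12ω²≉0
               (Fixed-* (Fixed-* (Fixed-num 3) (Fixed-* (Fixed-num 2) (Fixed-num 2))) (Fixed-square sω))))
               (Fixed-neg (Fixed-* fγ fγ))) (Fixed-recip 2γ≉0 (Fixed-* (Fixed-num 2) fγ))
        2γa+γ²≈-i : num 2 * γ * a + γ * γ ≈ - i
        2γa+γ²≈-i = modulo (- i - γ * γ) (recip-inverseʳ _ 2γ≉0)
          (solve 3 (λ γ i j → :num 2 :* γ :* ((:- i :- γ :* γ) :* j) :+ γ :* γ :=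
            :- i :+ (:- i :- γ :* γ) :* (:num 2 :* γ :* j :- :num 1)) refl γ i j)
        f[a+γ+ω]≈f[a+ω] : f (a + γ + ω) ≈ f (a + ω)
        f[a+γ+ω]≈f[a+ω] = begin
          f (a + γ + ω)
            ≈⟨ f-fixed+skew (Fixed-+ fa fγ) sω ⟩
          a + γ + ω + γ * (num 4 * (ω * ω) * (num 3 * ((a + γ) * (a + γ)) + ω * ω))
            ≈⟨ modulo (γ * (num 12 * (ω * ω))) 2γa+γ²≈-i (solve 4 (λ a γ ω i →
                 a :+ γ :+ ω :+ γ :* (:num 4 :* (ω :* ω) :* (:num 3 :* ((a :+ γ) :* (a :+ γ)) :+ ω :* ω)) :=
                 a :+ ω :+ γ :* (:num 4 :* (ω :* ω) :* (:num 3 :* (a :* a) :+ ω :* ω))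
                   :- γ :* (:num 3 :* (:num 2 :* :num 2) :* (ω :* ω) :* i :- :num 1)
                 :+ γ :* (:num 12 :* (ω :* ω)) :* (:num 2 :* γ :* a :+ γ :* γ :- :- i)) refl a γ ω i) ⟩
          fa+ω - γ * (num 3 * (num 2 * num 2) * (ω * ω) * i - num 1)
            ≈⟨ modulo (- γ) (recip-inverseʳ _ 12ω²≉0) (solve 3 (λ y γ z →
                 y :- γ :* (z :- :num 1) := y :+ (:- γ) :* (z :- :num 1)) refl fa+ω γ _) ⟩
          fa+ω
            ≈⟨ f-fixed+skew fa sω ⟨
          f (a + ω) ∎
          where fa+ω = a + ω + γ * (num 4 * (ω * ω) * (num 3 * (a * a) + ω * ω))

      -- Writing γ = c + ω with c fixed and ω skew, f (u + s ω) ≈ f (u - s c) for fixed u and s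
      -- amounts to the equation solved by quartic-solution, with D = ω².
      collision-nonfixed : ¬ Fixed γ → Collision
      collision-nonfixed ¬fγ = u + s * ω , u - s * c , fx≈fy , x≉y
        where
        ½ = recip (num 2) 2≉0
        f½ : Fixed ½
        f½ = Fixed-recip 2≉0 (Fixed-num 2)
        c = ½ * (γ + conj γ)
        ω = ½ * (γ - conj γ)
        c+ω≈γ : c + ω ≈ γ
        c+ω≈γ = modulo γ (recip-inverseʳ (num 2) 2≉0) (solve 3 (λ h x y →
          h :* (x :+ y) :+ h :* (x :- y) := x :+ x :* (:num 2 :* h :- :num 1)) refl ½ γ (conj γ))
        fc : Fixed c
        fc = Fixed-* f½ (trans (conj-+ _ _) (trans (+-congˡ (conj-involutive γ)) (+-comm _ _)))
        sω : Skew ω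
        sω = Fixed-*-Skew f½ (Skew-sub γ)
        ω≉0 : ω ≉ 0#
        ω≉0 = *-≉0 (recip-≉0 _ 2≉0) (λ eq → ¬fγ (sym (x-y≈0⇒x≈y _ _ eq)))
        D-in-K = Fixed⇒InSubfield (Fixed-square sω)
        D = proj₁ D-in-K
        ιD≈ω² = proj₂ D-in-K
        K-2≉0 : KNum.num 2 K.≉ K.0#
        K-2≉0 2≈0 = 2≉0 (trans (sym (ι-num 2)) (trans (⟦⟧-cong 2≈0) 0#-homo))
        K-3≉0 : KNum.num 3 K.≉ K.0#
        K-3≉0 3≈0 = 3≉0 (trans (sym (ι-num 3)) (trans (⟦⟧-cong 3≈0) 0#-homo))
        -- A square root r of D in 𝔽q would give ω = ± r, an element both fixed and skew, hence
        -- zero.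
        ¬Square[D] : ¬ Squares.Square K K-order D
        ¬Square[D] (r , r²≈D) = [ (λ ω≈r → ω≉0 (Skew∧Fixed⇒≈0 sω (Fixed-resp ω≈r (ι-fixed r)))) ,
                                  (λ ω≈-r → ω≉0 (Skew∧Fixed⇒≈0 sω (Fixed-resp ω≈-r (Fixed-neg (ι-fixed r))))) ]′
          (x²≈y²⇒x≈y⊎x≈-y (trans (sym ιD≈ω²) (trans (⟦⟧-cong (K.sym r²≈D)) (*-homo r r))))
        solution = MordellCurve.quartic-solution K K-order K-2≉0 K-3≉0 D ¬Square[D]
        sᴷ = proj₁ solution
        uᴷ = proj₁ (proj₂ solution)
        s = ι sᴷ
        u = ι uᴷ
        quartic-s-u : num 12 * (ω * ω) * s * (u * u) + num 4 * ((ω * ω) * (ω * ω)) * (s * s * s) ≈ - num 1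
        quartic-s-u = begin
          num 12 * (ω * ω) * s * (u * u) + num 4 * ((ω * ω) * (ω * ω)) * (s * s * s)
            ≈⟨ +-cong (*-congʳ (*-congʳ (*-cong (ι-num 12) ιD≈ω²)))
                      (*-congʳ (*-cong (ι-num 4) (*-cong ιD≈ω² ιD≈ω²))) ⟨
          ι (KNum.num 12) * ι D * s * (u * u) + ι (KNum.num 4) * (ι D * ι D) * (s * s * s)
            ≈⟨ +-cong (*-homo₄ _ _ _ (*-homo uᴷ uᴷ)) (trans (*-homo _ _) (*-cong (trans (*-homo _ _)
                 (*-congˡ (*-homo D D))) (trans (*-homo _ _) (*-congʳ (*-homo sᴷ sᴷ))))) ⟨
          ι (KNum.num 12 K.* D K.* sᴷ K.* (uᴷ K.* uᴷ)) + ι (KNum.num 4 K.* (D K.* D) K.* (sᴷ K.* sᴷ K.* sᴷ))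
            ≈⟨ +-homo _ _ ⟨
          ι (KNum.num 12 K.* D K.* sᴷ K.* (uᴷ K.* uᴷ) K.+ KNum.num 4 K.* (D K.* D) K.* (sᴷ K.* sᴷ K.* sᴷ))
            ≈⟨ ⟦⟧-cong (proj₂ (proj₂ solution)) ⟩
          ι (K.- K.1#)
            ≈⟨ trans (-‿homo K.1#) (-‿cong 1#-homo) ⟩
          - num 1 ∎
          where
          *-homo₄ : ∀ a b c {d d′} → ι d ≈ d′ → ι (a K.* b K.* c K.* d) ≈ ι a * ι b * ι c * d′
          *-homo₄ a b c eq = trans (*-homo _ _) (*-cong (trans (*-homo _ _) (*-congʳ (*-homo a b))) eq)
        s≉0 : s ≉ 0#
        s≉0 s≈0 = -‿≉0 1≉0 (trans (sym quartic-s-u) (modulo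
          (num 12 * (ω * ω) * (u * u) + num 4 * ((ω * ω) * (ω * ω)) * (s * s)) s≈0
          (solve 3 (λ w s u → :num 12 :* w :* s :* (u :* u) :+ :num 4 :* (w :* w) :* (s :* s :* s) :=
            :num 0 :+ (:num 12 :* w :* (u :* u) :+ :num 4 :* (w :* w) :* (s :* s)) :* (s :- :num 0)) refl (ω * ω) s u)))
        fx≈fy : f (u + s * ω) ≈ f (u - s * c)
        fx≈fy = begin
          f (u + s * ω)
            ≈⟨ f-fixed+skew (ι-fixed uᴷ) (Fixed-*-Skew (ι-fixed sᴷ) sω) ⟩
          u + s * ω + γ * (num 4 * ((s * ω) * (s * ω)) * (num 3 * (u * u) + (s * ω) * (s * ω)))
            -- The trace factor is s times the left side of `quartic-s-u`, hence equals - s.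
            ≈⟨ modulo (γ * s) quartic-s-u (solve 4 (λ u s ω γ →
                 u :+ s :* ω :+ γ :* (:num 4 :* ((s :* ω) :* (s :* ω)) :* (:num 3 :* (u :* u) :+ (s :* ω) :* (s :* ω))) :=
                 u :+ s :* ω :- s :* γ :+ (γ :* s) :* (:num 12 :* (ω :* ω) :* s :* (u :* u)
                   :+ :num 4 :* ((ω :* ω) :* (ω :* ω)) :* (s :* s :* s) :- :- :num 1)) refl u s ω γ) ⟩
          u + s * ω - s * γ
            ≈⟨ modulo s c+ω≈γ (solve 5 (λ u s ω γ c → u :+ s :* ω :- s :* γ :=
                 u :- s :* c :+ s :* (c :+ ω :- γ)) refl u s ω γ c) ⟩
          u - s * c
            -- The point u - s c lies in 𝔽q; with skew part 0 its trace factor vanishes, so f fixes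
            -- it.
            ≈⟨ solve 2 (λ y γ → y := y :+ :num 0 :+ γ :* (:num 4 :* (:num 0 :* :num 0) :* (:num 3 :* (y :* y) :+ :num 0 :* :num 0))) refl (u - s * c) γ ⟩
          u - s * c + 0# + γ * (num 4 * (0# * 0#) * (num 3 * ((u - s * c) * (u - s * c)) + 0# * 0#))
            ≈⟨ f-fixed+skew (Fixed-+ (ι-fixed uᴷ) (Fixed-neg (Fixed-* (ι-fixed sᴷ) fc)))
                 (trans conj-0 (solve 0 (:num 0 := :- :num 0) refl)) ⟨
          f (u - s * c + 0#)
            ≈⟨ f-cong (+-identityʳ _) ⟩
          f (u - s * c) ∎
        x≉y : u + s * ω ≉ u - s * c
        x≉y x≈y = *-≉0 s≉0 (λ γ≈0 → ¬fγ (Fixed-resp γ≈0 conj-0)) (begin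
          s * γ        ≈⟨ *-congˡ c+ω≈γ ⟨
          s * (c + ω)  ≈⟨ modulo (num 1) x≈y (solve 4 (λ u s ω c → s :* (c :+ ω) :=
                            :num 0 :+ :num 1 :* (u :+ s :* ω :- (u :- s :* c))) refl u s ω c) ⟩
          0#           ∎)

      IsPermutation⇒γ≈0 : IsPermutation L f → γ ≈ 0#
      IsPermutation⇒γ≈0 perm = decidable-stable (γ ≟ 0#) (λ γ≉0 →
        Collision⇒¬IsPermutation (collision-nonfixed (λ fγ →
          Collision⇒¬IsPermutation (collision-fixed γ≉0 fγ) perm)) perm)

    -- Characteristic 3

    module Characteristic3 (3≈0 : num 3 ≈ 0#) where

      fourth : Carrier → Carrier
      fourth x = x * x * (x * x)

      fourth-cong : ∀ {x y} → x ≈ y → fourth x ≈ fourth y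
      fourth-cong x≈y = *-cong (*-cong x≈y x≈y) (*-cong x≈y x≈y)

      -- Here x² + x y + y² = (x - y)² + 3 x y loses its last term.
      f-fourth : ∀ x → f x ≈ x + γ * fourth (x - conj x)
      f-fourth x = trans (f-quartic x) (modulo (γ * (x * conj x * (x - conj x) * (x - conj x))) 3≈0
        (solve 3 (λ γ x y → x :+ γ :* ((x :- y) :* (x :- y) :* (x :* x :+ x :* y :+ y :* y)) :=
          x :+ γ :* ((x :- y) :* (x :- y) :* ((x :- y) :* (x :- y)))
          :+ (γ :* (x :* y :* (x :- y) :* (x :- y))) :* (:num 3 :- :num 0)) refl γ x (conj x)))

      -- In characteristic 3 cubing is additive, so x - y has cube 0.
      cube-injective : ∀ {x y} → x * x * x ≈ y * y * y → x ≈ y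
      cube-injective {x} {y} x³≈y³ = x-y≈0⇒x≈y x y (decidable-stable (x - y ≟ 0#)
        (λ x-y≉0 → *-≉0 (*-≉0 x-y≉0 x-y≉0) x-y≉0 (begin
          (x - y) * (x - y) * (x - y)   ≈⟨ modulo (- (x * y * (x - y))) 3≈0 (solve 2 (λ x y →
                                             (x :- y) :* (x :- y) :* (x :- y) := x :* x :* x :- y :* y :* y
                                             :+ (:- (x :* y :* (x :- y))) :* (:num 3 :- :num 0)) refl x y) ⟩
          x * x * x - y * y * y         ≈⟨ +-congʳ x³≈y³ ⟩
          y * y * y - y * y * y         ≈⟨ -‿inverseʳ _ ⟩
          0#                            ∎)))

      -- Since γ is fixed, f preserves x - conj x.
      Fixed⇒IsPermutation : Fixed γ → IsPermutation L f
      Fixed⇒IsPermutation fγ = mkPermutation (λ y → y - γ * fourth (y - conj y)) f-injective f-inverse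
        where
        conj-shift : ∀ δ x → conj (x + γ * fourth (δ - conj δ)) ≈ conj x + γ * fourth (δ - conj δ)
        conj-shift δ x = trans (conj-+ _ _) (+-congˡ (Fixed-* fγ (Fixed-* fδ² fδ²)))
          where fδ² = Fixed-square (Skew-sub δ)
        f-sub-conj : ∀ x → f x - conj (f x) ≈ x - conj x
        f-sub-conj x = begin
          f x - conj (f x)
            ≈⟨ +-cong (f-fourth x) (-‿cong (trans (conj-cong (f-fourth x)) (conj-shift x x))) ⟩
          (x + g) - (conj x + g)
            ≈⟨ solve 3 (λ x y g → x :+ g :- (y :+ g) := x :- y) refl x (conj x) g ⟩
          x - conj x ∎
          where g = γ * fourth (x - conj x)
        f-injective : ∀ {x y} → f x ≈ f y → x ≈ y
        f-injective {x} {y} fx≈fy = begin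
          x                                        ≈⟨ solve 2 (λ x g → x := x :+ g :- g) refl x (γ * fourth (x - conj x)) ⟩
          x + γ * fourth (x - conj x) - γ * fourth (x - conj x)
            ≈⟨ +-cong (trans (sym (f-fourth x)) (trans fx≈fy (f-fourth y)))
                      (-‿cong (*-congˡ (fourth-cong δx≈δy))) ⟩
          y + γ * fourth (y - conj y) - γ * fourth (y - conj y)
                                                   ≈⟨ solve 2 (λ x g → x :+ g :- g := x) refl y (γ * fourth (y - conj y)) ⟩
          y                                        ∎
          where
          δx≈δy : x - conj x ≈ y - conj y
          δx≈δy = trans (sym (f-sub-conj x)) (trans (+-cong fx≈fy (-‿cong (conj-cong fx≈fy))) (f-sub-conj y))
        f-inverse : ∀ y → f (y - γ * fourth (y - conj y)) ≈ y
        f-inverse y = begin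
          f x                           ≈⟨ f-fourth x ⟩
          x + γ * fourth (x - conj x)   ≈⟨ +-congˡ (*-congˡ (fourth-cong δx≈δy)) ⟩
          y - g + g                     ≈⟨ solve 2 (λ y g → y :- g :+ g := y) refl y g ⟩
          y                             ∎
          where
          g = γ * fourth (y - conj y)
          x = y - g
          δx≈δy : x - conj x ≈ y - conj y
          δx≈δy = begin
            y - g - conj (y - g)          ≈⟨ +-congˡ (-‿cong (trans (conj-sub y g) (+-congˡ (-‿cong
                                               (Fixed-* fγ (Fixed-* (Fixed-square (Skew-sub y)) (Fixed-square (Skew-sub y)))))))) ⟩
            y - g - (conj y - g)          ≈⟨ solve 3 (λ y z g → y :- g :- (z :- g) := y :- z) refl y (conj y) g ⟩
            y - conj y                    ∎

      -- A skew root D of (γ - conj γ) D³ = - 1 gives the second zero - γ D⁴ of f.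
      collision : ¬ Fixed γ → Collision
      collision ¬fγ = x , 0# , trans fx≈0 (sym f0≈0) , x≉0
        where
        t = γ - conj γ
        t≉0 : t ≉ 0#
        t≉0 eq = ¬fγ (sym (x-y≈0⇒x≈y _ _ eq))
        t⁻¹ = recip t t≉0
        root = injective⇒surjective cube-injective (- t⁻¹)
        D = proj₁ root
        D³≈-t⁻¹ = proj₂ root
        -- Conjugating D³ = - t⁻¹ changes its sign because t is skew; cube roots being unique, it
        -- also changes the sign of D.
        sD : Skew D
        sD = cube-injective (begin
          conj D * conj D * conj D  ≈⟨ trans (conj-* _ _) (*-congʳ (conj-* _ _)) ⟨
          conj (D * D * D)          ≈⟨ conj-cong D³≈-t⁻¹ ⟩
          conj (- t⁻¹)              ≈⟨ trans (conj-neg _) (-‿cong (Skew-recip t≉0 (Skew-sub γ))) ⟩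
          - - t⁻¹                   ≈⟨ -‿cong D³≈-t⁻¹ ⟨
          - (D * D * D)             ≈⟨ solve 1 (λ D → :- (D :* D :* D) := :- D :* :- D :* :- D) refl D ⟩
          - D * - D * - D           ∎)
        D≉0 : D ≉ 0#
        D≉0 = factorʳ-≉0 (λ D³≈0 → -‿≉0 (recip-≉0 t t≉0) (trans (sym D³≈-t⁻¹) D³≈0))
        -- A zero x of f has the form - γ D⁴ with D = x - x̄. For skew D this is consistent when -
        -- (γ - γ̄) D⁴ = D, whose nonzero solutions satisfy t D³ = - 1.
        x = - (γ * fourth D)
        x-x̄≈D : x - conj x ≈ D
        x-x̄≈D = begin
          x - conj x
            ≈⟨ +-congˡ (-‿cong (trans (conj-neg _) (-‿cong (trans (conj-* _ _) (*-congˡ (Fixed-* (Fixed-square sD) (Fixed-square sD))))))) ⟩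
          - (γ * fourth D) - - (conj γ * fourth D)
            ≈⟨ modulo (- (t * D)) D³≈-t⁻¹ (solve 4 (λ x y D i →
                 :- (x :* (D :* D :* (D :* D))) :- :- (y :* (D :* D :* (D :* D))) :=
                 (x :- y) :* i :* D :+ (:- ((x :- y) :* D)) :* (D :* D :* D :- :- i)) refl γ (conj γ) D t⁻¹) ⟩
          t * t⁻¹ * D
            ≈⟨ trans (*-congʳ (recip-inverseʳ t t≉0)) (*-identityˡ D) ⟩
          D ∎
        fx≈0 : f x ≈ 0#
        fx≈0 = trans (f-fourth x) (trans (+-congˡ (*-congˡ (fourth-cong x-x̄≈D))) (-‿inverseˡ _))
        f0≈0 : f 0# ≈ 0#
        f0≈0 = trans (f-fourth 0#) (trans (+-congˡ (*-congˡ (fourth-cong (+-congˡ (-‿cong conj-0)))))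
          (solve 1 (λ γ → :num 0 :+ γ :* ((:num 0 :- :num 0) :* (:num 0 :- :num 0) :* ((:num 0 :- :num 0) :* (:num 0 :- :num 0)))
            := :num 0) refl γ))
        x≉0 : x ≉ 0#
        x≉0 x≈0 = D≉0 (begin
          D            ≈⟨ x-x̄≈D ⟨
          x - conj x   ≈⟨ +-cong x≈0 (-‿cong (trans (conj-cong x≈0) conj-0)) ⟩
          0# - 0#      ≈⟨ -‿inverseʳ 0# ⟩
          0#           ∎)

      IsPermutation⇒Fixed : IsPermutation L f → Fixed γ
      IsPermutation⇒Fixed perm = decidable-stable (conj γ ≟ γ)
        (λ ¬fγ → Collision⇒¬IsPermutation (collision ¬fγ) perm)

open import Data.Nat using (_*_)

theorem3p7 : ∀ {c₁ ℓ₁ c₂ ℓ₂} (q : ℕ) → IsPrimePower q → 2 ∤ q →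
    (𝔽q : Field c₁ ℓ₁) → HasOrder 𝔽q q →
    (𝔽q² : Field c₂ ℓ₂) → HasOrder 𝔽q² (q * q) →
    (emb : Embedding 𝔽q 𝔽q²) →
    (γ : Field.Carrier 𝔽q²) →
    (¬ HasCharacteristic 𝔽q² 3 →
    IsPermutation 𝔽q² (traceMap 𝔽q² q γ) ⇔ Field._≈_ 𝔽q² γ (Field.0# 𝔽q²))
    × (HasCharacteristic 𝔽q² 3 →
    IsPermutation 𝔽q² (traceMap 𝔽q² q γ) ⇔ Embedding.InSubfield emb γ)
theorem3p7 q (p , k , p-prime , ≡.refl) 2∤q 𝔽q 𝔽q-order 𝔽q² 𝔽q²-order emb γ =
  -- As 3 is prime, its vanishing in the field already forces characteristic 3.
  (λ ¬char3 → let open NotCharacteristic3 (λ 3≈0 → ¬char3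
                    (Characteristic.prime-characteristic 𝔽q² prime[3] (trans (·1≈num 3) 3≈0)))
              in mk⇔ IsPermutation⇒γ≈0 γ≈0⇒IsPermutation) ,
  (λ char3 → let open Characteristic3 (trans (sym (·1≈num 3)) (Equivalence.from (char3 3) ∣-refl))
             in mk⇔ (Fixed⇒InSubfield ∘ IsPermutation⇒Fixed) (Fixed⇒IsPermutation ∘ InSubfield⇒Fixed))
  where
  open Field 𝔽q² using (commutativeRing; trans; sym)
  open IntegerCoefficients commutativeRing using (·1≈num)
  open QuadraticExtension {k = k} p-prime 2∤q 𝔽q 𝔽q-order 𝔽q² 𝔽q²-order emb
  open TraceMap γ
  prime[3] : Prime 3
  prime[3] = from-yes (prime? 3)
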